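{- There is an algorithm with the following property. Let $p,q$ be primes with $q<p<2q$ and let $n=pq$. Let $e>1$ be an integer coprime with $\varphi(n)=(p-1)(q-1)$, and let $d=e^{ -1}\pmod{\varphi(n)}$, so that $ed-k\varphi(n)=1$ for some integer $k$. Suppose $p+q-1=x+R$ with $x,R$ integers and $R>0$. If $$d<\left(\sqrt{2/3}\,n-\sqrt{3n}\right)(eR)^{ -1/2},$$ then the algorithm, given as input only $n$, $e$ and $x$ (and not $p,q,d,k,R$), outputs the factors $p$ and $q$ in time polynomial in $\log(en)$.
   Context: $\varphi$ is Euler's totient function. The inverse $d=e^{ -1}\pmod{\varphi(n)}$ is taken as the integer representative with $1\le d<\varphi(n)$. The number $x$ is the known part of $p+q-1$ (i.e. it is given to the algorithm) and $R$ is the unknown remainder. Running time is measured in bit operations. -}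

module Defs where

open import Data.Bool.Base using (if_then_else_)
open import Data.Empty using (⊥-elim)
open import Data.Integer.Base as ℤ using (ℤ; +_; -[1+_])
import Data.Integer.Properties as ℤ
import Data.Integer.Solver as ℤ
open import Data.List.Base using (List; []; _∷_; filter; length; map; upTo)
open import Data.Nat.Base as ℕ using (ℕ; zero; suc)
open import Data.Nat.Coprimality using (coprime?)
open import Data.Nat.Logarithm using (⌈log₂_⌉)
import Data.Nat.Properties as ℕ
open import Data.Product.Base using (∃; ∃₂; _×_; _,_; proj₁; proj₂)
open import Data.Rational.Base as ℚ
  using (ℚ; mkℚ; 0ℚ; 1ℚ; _<_; _≤_; _+_; _*_; _-_; -_; 1/_; _⊔_)
open import Data.Rational.Literals using (fromℤ)
import Data.Rational.Properties as ℚ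
open import Data.Rational.Solver using (module +-*-Solver)
import Data.Rational.Unnormalised.Base as ℚᵘ
import Data.Rational.Unnormalised.Properties as ℚᵘ
open import Data.Sum.Base using (_⊎_; inj₁; inj₂)
open import Relation.Binary.PropositionalEquality.Core
  using (_≡_; _≢_; refl; sym; trans; cong; subst; subst₂)
open import Relation.Nullary.Decidable.Core using (yes; no)

φ : ℕ → ℕ
φ n = length (filter (λ k → coprime? k n) (map suc (upTo n)))

-- Coefficients are listed from the constant term upwards.
Polynomial : Set
Polynomial = List ℕ

eval : Polynomial → ℕ → ℕ
eval []       x = 0
eval (c ∷ cs) x = c ℕ.+ x ℕ.* eval cs x

-- Algorithms are programs for a register machine over ℕ. Running time counts
-- bit operations: each instruction is charged the cost of the schoolbook method
-- on the binary representations of its operands, so no instruction handles a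
-- long number at unit cost.

Reg : Set
Reg = ℕ

data Op : Set where
  add monus mul quot rem : Op

-- quot x 0 = 0 and rem x 0 = x are conventions.
apply : Op → ℕ → ℕ → ℕ
apply add   x y       = x ℕ.+ y
apply monus x y       = x ℕ.∸ y
apply mul   x y       = x ℕ.* y
apply quot  x zero    = 0
apply quot  x (suc y) = x ℕ./ suc y
apply rem   x zero    = x
apply rem   x (suc y) = x ℕ.% suc y

-- The number of binary digits of x; bits 0 = 0.
bits : ℕ → ℕ
bits x = ⌈log₂ suc x ⌉

cost : Op → ℕ → ℕ → ℕ
cost add   x y = suc (bits x ℕ.+ bits y)
cost monus x y = suc (bits x ℕ.+ bits y)
cost mul   x y = suc (bits x) ℕ.* suc (bits y)
cost quot  x y = suc (bits x) ℕ.* suc (bits y)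
cost rem   x y = suc (bits x) ℕ.* suc (bits y)

infix  6 _≔_ _≔_⟨_⟩_
infixr 5 _⨾_

data Program : Set where
  skip         : Program
  _≔_          : Reg → ℕ → Program
  _≔_⟨_⟩_      : Reg → Reg → Op → Reg → Program
  _⨾_          : Program → Program → Program
  ifNonZero    : Reg → Program → Program → Program
  whileNonZero : Reg → Program → Program

State : Set
State = Reg → ℕ

_[_↦_] : State → Reg → ℕ → State
(σ [ r ↦ v ]) s = if s ℕ.≡ᵇ r then v else σ s

infix 3 _,_⇓_[_]

-- P , σ ⇓ τ [ t ]: started in σ, P halts in τ after t bit operations.
data _,_⇓_[_] : Program → State → State → ℕ → Set where
  skip : ∀ {σ} → skip , σ ⇓ σ [ 0 ]
  literal : ∀ {σ r c} → (r ≔ c) , σ ⇓ σ [ r ↦ c ] [ suc (bits c) ]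
  operate : ∀ {σ r s o u} →
    (r ≔ s ⟨ o ⟩ u) , σ ⇓ σ [ r ↦ apply o (σ s) (σ u) ] [ cost o (σ s) (σ u) ]
  seq : ∀ {P Q σ τ υ t t′} → P , σ ⇓ τ [ t ] → Q , τ ⇓ υ [ t′ ] →
    (P ⨾ Q) , σ ⇓ υ [ t ℕ.+ t′ ]
  if-true : ∀ {r P Q σ τ t} → σ r ≢ 0 → P , σ ⇓ τ [ t ] →
    ifNonZero r P Q , σ ⇓ τ [ suc (bits (σ r)) ℕ.+ t ]
  if-false : ∀ {r P Q σ τ t} → σ r ≡ 0 → Q , σ ⇓ τ [ t ] →
    ifNonZero r P Q , σ ⇓ τ [ suc (bits (σ r)) ℕ.+ t ]
  while-true : ∀ {r P σ τ υ t t′} → σ r ≢ 0 →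
    P , σ ⇓ τ [ t ] → whileNonZero r P , τ ⇓ υ [ t′ ] →
    whileNonZero r P , σ ⇓ υ [ suc (bits (σ r)) ℕ.+ t ℕ.+ t′ ]
  while-false : ∀ {r P σ} → σ r ≡ 0 →
    whileNonZero r P , σ ⇓ σ [ suc (bits (σ r)) ]

signBit : ℤ → ℕ
signBit (+ _)    = 0
signBit -[1+ _ ] = 1

-- x is passed as a sign bit and an absolute value; all other registers are 0.
input : ℕ → ℕ → ℤ → State
input n e x 0 = n
input n e x 1 = e
input n e x 2 = signBit x
input n e x 3 = ℤ.∣ x ∣
input n e x _ = 0

module Order where

  open +-*-Solver

  0<1 : 0ℚ < 1ℚ
  0<1 = ℚ.*<* (ℤ.+<+ (ℕ.s≤s ℕ.z≤n))

  diff : ∀ {p q} → p < q → 0ℚ < q - p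
  diff {p} {q} h = subst (_< q - p) (ℚ.+-inverseʳ p) (ℚ.+-monoˡ-< (- p) h)

  undiff : ∀ {p q} → 0ℚ < q - p → p < q
  undiff {p} {q} h = subst₂ _<_ (ℚ.+-identityˡ p)
    (solve 2 (λ a b → (a :- b) :+ b := a) refl q p) (ℚ.+-monoˡ-< p h)

  pos* : ∀ {a b} → 0ℚ < a → 0ℚ < b → 0ℚ < a * b
  pos* {a} {b} ha hb = subst (_< a * b) (ℚ.*-zeroˡ b)
    (ℚ.*-monoˡ-<-pos b {{ℚ.positive hb}} ha)

  nn* : ∀ {a b} → 0ℚ ≤ a → 0ℚ ≤ b → 0ℚ ≤ a * b
  nn* {a} {b} ha hb = subst (_≤ a * b) (ℚ.*-zeroˡ b)
    (ℚ.*-monoʳ-≤-nonNeg b {{ℚ.nonNegative hb}} ha)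

  pos+ : ∀ {a b} → 0ℚ < a → 0ℚ ≤ b → 0ℚ < a + b
  pos+ {a} {b} ha hb = subst (_< a + b) (ℚ.+-identityˡ 0ℚ) (ℚ.+-mono-<-≤ ha hb)

  pos++ : ∀ {a b} → 0ℚ < a → 0ℚ < b → 0ℚ < a + b
  pos++ ha hb = pos+ ha (ℚ.<⇒≤ hb)

  nn+ : ∀ {a b} → 0ℚ ≤ a → 0ℚ ≤ b → 0ℚ ≤ a + b
  nn+ {a} {b} ha hb = subst (_≤ a + b) (ℚ.+-identityˡ 0ℚ) (ℚ.+-mono-≤ ha hb)

  -- δ = c / (M + c)
  shrink′ : ∀ {c M} → 0ℚ < c → 0ℚ < M → ∃ λ δ → 0ℚ < δ × δ < 1ℚ × δ * M < c
  shrink′ {c} {M} hc hM = δ , δ>0 , δ<1 , δM<c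
    where
    s = M + c
    hs : 0ℚ < s
    hs = pos++ hM hc
    instance
      s>0 : ℚ.Positive s
      s>0 = ℚ.positive hs
      s≢0 : ℚ.NonZero s
      s≢0 = ℚ.pos⇒nonZero s
    i = 1/ s
    hi : 0ℚ < i
    hi = ℚ.positive⁻¹ i {{ℚ.1/pos⇒pos s}}
    δ = c * i
    is : i * s ≡ 1ℚ
    is = ℚ.*-inverseˡ s
    δ>0 = pos* hc hi
    1-δ : M * i ≡ 1ℚ - δ
    1-δ = trans (solve 3 (λ M c i → M :* i := i :* (M :+ c) :- c :* i) refl M c i)
                (cong (_- δ) is)
    δ<1 : δ < 1ℚ
    δ<1 = undiff (subst (0ℚ <_) 1-δ (pos* hM hi))
    δM<c : δ * M < c
    δM<c = undiff (subst (0ℚ <_) eq (pos* hc δ>0))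
      where
      eq : c * δ ≡ c - δ * M
      eq = trans (solve 3 (λ M c i → c :* (c :* i) := c :* (i :* (M :+ c)) :- (c :* i) :* M) refl M c i)
                 (cong (_- δ * M) (trans (cong (c *_) is) (ℚ.*-identityʳ c)))

  ⅓ : ℚ
  ⅓ = + 1 ℚ./ 3

  0<⅓ : 0ℚ < ⅓
  0<⅓ = ℚ.*<* (ℤ.+<+ (ℕ.s≤s ℕ.z≤n))

  third′ : ∀ {ε} → 0ℚ < ε → ∃ λ δ → 0ℚ < δ × δ + δ < ε
  third′ {ε} hε = ⅓ * ε , h , undiff (subst (0ℚ <_)
      (solve 1 (λ e → con ⅓ :* e := e :- (con ⅓ :* e :+ con ⅓ :* e)) refl ε) h)
    where
    h : 0ℚ < ⅓ * ε
    h = pos* {⅓} {ε} 0<⅓ hε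

  ι : ℕ → ℚ
  ι n = fromℤ (+ n)

  ι-suc : ∀ n → ι (suc n) ≡ 1ℚ + ι n
  ι-suc n = ℚ.toℚᵘ-injective (ℚᵘ.≃-trans (ℚᵘ.*≡* eq) (ℚᵘ.≃-sym (ℚ.toℚᵘ-homo-+ 1ℚ (ι n))))
    where
    eq : + suc n ℤ.* (+ 1 ℤ.* + 1) ≡ (+ 1 ℤ.* + 1 ℤ.+ + n ℤ.* + 1) ℤ.* + 1
    eq = ℤS.solve 1 (λ n → (ℤS.con (+ 1) ℤS.:+ n) ℤS.:* ℤS.con (+ 1)
      ℤS.:= (ℤS.con (+ 1) ℤS.:+ n ℤS.:* ℤS.con (+ 1)) ℤS.:* ℤS.con (+ 1)) refl (+ n)
      where module ℤS = ℤ.+-*-Solver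

  ι≥0 : ∀ n → 0ℚ ≤ ι n
  ι≥0 n = ℚ.*≤* (subst (+ 0 ℤ.≤_) (ℤ.pos-* n 1) (ℤ.+≤+ ℕ.z≤n))

  <ι : ∀ q → ∃ λ n → q < ι n
  <ι (mkℚ -[1+ n ] d c) = 1 , ℚ.*<* ℤ.-<+
  <ι (mkℚ (+ n) d c) = suc n , ℚ.*<* (subst₂ ℤ._<_ (ℤ.pos-* n 1) (ℤ.pos-* (suc n) (suc d))
    (ℤ.+<+ (ℕ.<-≤-trans
      (ℕ.≤-reflexive (cong suc (ℕ.*-identityʳ n))) (ℕ.m≤m*n (suc n) (suc d)))))

  archimedean′ : ∀ {δ} M → 0ℚ < δ → ∃ λ n → M < ι n * δ
  archimedean′ {δ} M hδ = n , subst (_< ι n * δ) eq (ℚ.*-monoˡ-<-pos δ {{ℚ.positive hδ}} h)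
    where
    instance
      δ≢0 : ℚ.NonZero δ
      δ≢0 = ℚ.>-nonZero hδ
    n = proj₁ (<ι (M * 1/ δ))
    h = proj₂ (<ι (M * 1/ δ))
    eq : M * 1/ δ * δ ≡ M
    eq = trans (ℚ.*-assoc M (1/ δ) δ) (trans (cong (M *_) (ℚ.*-inverseˡ δ)) (ℚ.*-identityʳ M))

  sq-mono : ∀ {p q} → 0ℚ ≤ p → p < q → p * p < q * q
  sq-mono {p} {q} hp h = undiff {p * p} {q * q} (subst (0ℚ <_)
    (solve 2 (λ p q → (q :- p) :* (q :- p) :+ (p :+ p) :* (q :- p) := q :* q :- p :* p) refl p q)
    (pos+ {(q - p) * (q - p)} {(p + p) * (q - p)} (pos* {q - p} {q - p} (diff h) (diff h))
      (nn* {p + p} {q - p} (nn+ {p} {p} hp hp) (ℚ.<⇒≤ (diff h)))))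

  sq-mono≤ : ∀ {p q} → 0ℚ ≤ p → p ≤ q → p * p ≤ q * q
  sq-mono≤ {p} {q} hp h = ℚ.≤-trans (ℚ.*-monoʳ-≤-nonNeg p {{ℚ.nonNegative hp}} h)
    (ℚ.*-monoˡ-≤-nonNeg q {{ℚ.nonNegative (ℚ.≤-trans hp h)}} h)

  -- A bound on two corners of an interval bounds the products in between.
  edge : ∀ {q a b s t} → a ≤ s → s ≤ b → q < a * t → q < b * t → q < s * t
  edge {q} {a} {b} {s} {t} as sb h₁ h₂ with ℚ.≤-total 0ℚ t
  ... | inj₁ t≥0 = ℚ.<-≤-trans h₁ (ℚ.*-monoʳ-≤-nonNeg t {{ℚ.nonNegative t≥0}} as)
  ... | inj₂ t≤0 = ℚ.<-≤-trans h₂ (ℚ.*-monoʳ-≤-nonPos t {{ℚ.nonPositive t≤0}} sb)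

  edge′ : ∀ {q a b s t} → a ≤ s → s ≤ b → a * t < q → b * t < q → s * t < q
  edge′ {q} {a} {b} {s} {t} as sb h₁ h₂ with ℚ.≤-total 0ℚ t
  ... | inj₁ t≥0 = ℚ.≤-<-trans (ℚ.*-monoʳ-≤-nonNeg t {{ℚ.nonNegative t≥0}} sb) h₂
  ... | inj₂ t≤0 = ℚ.≤-<-trans (ℚ.*-monoʳ-≤-nonPos t {{ℚ.nonPositive t≤0}} as) h₁

  swap< : ∀ {q} a b → q < a * b → q < b * a
  swap< {q} a b = subst (q <_) (ℚ.*-comm a b)

  swap> : ∀ {q} a b → a * b < q → b * a < q
  swap> {q} a b = subst (_< q) (ℚ.*-comm a b)

  corners : ∀ {q a b c d s t} → a ≤ s → s ≤ b → c ≤ t → t ≤ d →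
    q < a * c → q < a * d → q < b * c → q < b * d → q < s * t
  corners {a = a} {b} {c} {d} {s} {t} as sb ct td h₁ h₂ h₃ h₄ = edge as sb
    (swap< t a (edge ct td (swap< a c h₁) (swap< a d h₂)))
    (swap< t b (edge ct td (swap< b c h₃) (swap< b d h₄)))

  corners′ : ∀ {q a b c d s t} → a ≤ s → s ≤ b → c ≤ t → t ≤ d →
    a * c < q → a * d < q → b * c < q → b * d < q → s * t < q
  corners′ {a = a} {b} {c} {d} {s} {t} as sb ct td h₁ h₂ h₃ h₄ = edge′ as sb
    (swap> t a (edge′ ct td (swap> a c h₁) (swap> a d h₂)))
    (swap> t b (edge′ ct td (swap> b c h₃) (swap> b d h₄)))

  glb : ∀ {q a b} → q < a → q < b → ∃ λ m → q < m × m ≤ a × m ≤ b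
  glb {q} {a} {b} ha hb with ℚ.≤-total a b
  ... | inj₁ a≤b = a , ha , ℚ.≤-refl , a≤b
  ... | inj₂ b≤a = b , hb , b≤a , ℚ.≤-refl

  lub : ∀ {q a b} → a < q → b < q → ∃ λ m → m < q × a ≤ m × b ≤ m
  lub {q} {a} {b} ha hb with ℚ.≤-total a b
  ... | inj₁ a≤b = b , hb , a≤b , ℚ.≤-refl
  ... | inj₂ b≤a = a , ha , ℚ.≤-refl , b≤a

  -- w * t for 0 < w < δ and ∣ t ∣ < K
  small : ∀ {w δ t K} → 0ℚ < w → w < δ → - K < t → t < K →
    0ℚ < δ * K - w * t × 0ℚ < δ * K + w * t
  small {w} {δ} {t} {K} hw hδ h₁ h₂ =
      subst (0ℚ <_) (solve 4 (λ w d t k → (d :- w) :* k :+ w :* (k :- t) := d :* k :- w :* t) refl w δ t K)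
        (pos++ (pos* (diff hδ) K>0) (pos* hw (diff h₂)))
    , subst (0ℚ <_) (solve 4 (λ w d t k → (d :- w) :* k :+ w :* (t :- (:- k)) := d :* k :+ w :* t) refl w δ t K)
        (pos++ (pos* (diff hδ) K>0) (pos* hw (diff h₁)))
    where
    K>0 : 0ℚ < K
    K>0 = subst (0ℚ <_) (solve 1 (λ k → con ½ :* (k :- (:- k)) := k) refl K)
        (pos* {½} {K - - K} (ℚ.*<* (ℤ.+<+ (ℕ.s≤s ℕ.z≤n))) (diff (ℚ.<-trans h₁ h₂)))
      where
      ½ : ℚ
      ½ = + 1 ℚ./ 2

  ⊔-<ˡ : ∀ {p} q r → p < q → p < q ⊔ r
  ⊔-<ˡ q r h = ℚ.<-≤-trans h (ℚ.p≤p⊔q q r)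

  ⊔-<ʳ : ∀ {p} q r → p < r → p < q ⊔ r
  ⊔-<ʳ q r h = ℚ.<-≤-trans h (ℚ.p≤q⊔p q r)

  -- Without abstract, `with third h` unfolds the rational arithmetic inside.
  abstract
    third : ∀ {ε} → 0ℚ < ε → ∃ λ δ → 0ℚ < δ × δ + δ < ε
    third = third′

    shrink : ∀ {c M} → 0ℚ < c → 0ℚ < M → ∃ λ δ → 0ℚ < δ × δ < 1ℚ × δ * M < c
    shrink = shrink′

    archimedean : ∀ {δ} M → 0ℚ < δ → ∃ λ n → M < ι n * δ
    archimedean = archimedean′

    dense : ∀ {p q} → p < q → ∃ λ m → p < m × m < q
    dense = ℚ.<-dense

    compare : ∀ p q → p < q ⊎ q ≤ p
    compare p q with p ℚ.<? q
    ... | yes h = inj₁ h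
    ... | no h = inj₂ (ℚ.≮⇒≥ h)

open Order

-- Real numbers as two-sided Dedekind cuts of the rationals; located with ε = 1
-- makes both sides inhabited.
record ℝ : Set₁ where
  field
    Lower Upper : ℚ → Set
    lower-down : ∀ {p q} → p < q → Lower q → Lower p
    lower-open : ∀ {q} → Lower q → ∃ λ r → q < r × Lower r
    upper-up   : ∀ {p q} → p < q → Upper p → Upper q
    upper-open : ∀ {q} → Upper q → ∃ λ r → r < q × Upper r
    ordered    : ∀ {l u} → Lower l → Upper u → l < u
    located    : ∀ ε → 0ℚ < ε → ∃₂ λ l u → Lower l × Upper u × u - l < ε

open ℝ

infix  4 _<ᵣ_
infixl 6 _-ᵣ_
infixl 7 _*ᵣ_

_<ᵣ_ : ℝ → ℝ → Set
x <ᵣ y = ∃ λ q → Upper x q × Lower y q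

private
  maxL : ∀ (x : ℝ) {a a′} → Lower x a → Lower x a′ → ∃ λ m → Lower x m × a ≤ m × a′ ≤ m
  maxL x {a} {a′} h h′ with ℚ.≤-total a a′
  ... | inj₁ le = a′ , h′ , le , ℚ.≤-refl
  ... | inj₂ le = a , h , ℚ.≤-refl , le

ratᵣ : ℚ → ℝ
ratᵣ r .Lower q = q < r
ratᵣ r .Upper q = r < q
ratᵣ r .lower-down = ℚ.<-trans
ratᵣ r .lower-open h = let m , a , b = dense h in m , a , b
ratᵣ r .upper-up p<q h = ℚ.<-trans h p<q
ratᵣ r .upper-open h = let m , a , b = dense h in m , b , a
ratᵣ r .ordered = ℚ.<-trans
ratᵣ r .located ε hε with third hε
... | δ , hδ , h = r - δ , r + δ
    , undiff (subst (0ℚ <_) (solve 2 (λ d r → d := r :- (r :- d)) refl δ r) hδ)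
    , undiff (subst (0ℚ <_) (solve 2 (λ d r → d := (r :+ d) :- r) refl δ r) hδ)
    , subst (_< ε) (solve 2 (λ d r → d :+ d := (r :+ d) :- (r :- d)) refl δ r) h
  where open +-*-Solver

natᵣ : ℕ → ℝ
natᵣ n = ratᵣ (+ n ℚ./ 1)

_-ᵣ_ : ℝ → ℝ → ℝ
(x -ᵣ y) .Lower q = ∃₂ λ a b → Lower x a × Upper y b × q ≤ a - b
(x -ᵣ y) .Upper q = ∃₂ λ a b → Upper x a × Lower y b × a - b ≤ q
(x -ᵣ y) .lower-down p<q (a , b , ha , hb , h) = a , b , ha , hb , ℚ.≤-trans (ℚ.<⇒≤ p<q) h
(x -ᵣ y) .lower-open (a , b , ha , hb , h) with lower-open x ha
... | a′ , a<a′ , ha′ = a′ - b , ℚ.≤-<-trans h (ℚ.+-monoˡ-< (- b) a<a′)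
                      , a′ , b , ha′ , hb , ℚ.≤-refl
(x -ᵣ y) .upper-up p<q (a , b , ha , hb , h) = a , b , ha , hb , ℚ.≤-trans h (ℚ.<⇒≤ p<q)
(x -ᵣ y) .upper-open (a , b , ha , hb , h) with upper-open x ha
... | a′ , a′<a , ha′ = a′ - b , ℚ.<-≤-trans (ℚ.+-monoˡ-< (- b) a′<a) h
                      , a′ , b , ha′ , hb , ℚ.≤-refl
(x -ᵣ y) .ordered (a , b , ha , hb , h) (a′ , b′ , ha′ , hb′ , h′) =
  ℚ.≤-<-trans h (ℚ.<-≤-trans
    (ℚ.+-mono-< (ordered x ha ha′) (ℚ.neg-antimono-< (ordered y hb′ hb))) h′)
(x -ᵣ y) .located ε hε with third hε
... | δ , hδ , h with located x δ hδ | located y δ hδ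
... | a , a′ , ha , ha′ , hx | b′ , b , hb′ , hb , hy =
      a - b , a′ - b′ , (a , b , ha , hb , ℚ.≤-refl) , (a′ , b′ , ha′ , hb′ , ℚ.≤-refl)
    , ℚ.<-trans (subst (_< δ + δ)
        (solve 4 (λ a a′ b b′ → (a′ :- a) :+ (b :- b′) := (a′ :- b′) :- (a :- b)) refl a a′ b b′)
        (ℚ.+-mono-< hx hy)) h
  where open +-*-Solver

_*ᵣ_ : ℝ → ℝ → ℝ
(x *ᵣ y) .Lower q = ∃₂ λ a b → ∃₂ λ c d → Lower x a × Upper x b × Lower y c × Upper y d ×
  q < a * c × q < a * d × q < b * c × q < b * d
(x *ᵣ y) .Upper q = ∃₂ λ a b → ∃₂ λ c d → Lower x a × Upper x b × Lower y c × Upper y d ×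
  a * c < q × a * d < q × b * c < q × b * d < q
(x *ᵣ y) .lower-down p<q (a , b , c , d , ha , hb , hc , hd , h₁ , h₂ , h₃ , h₄) =
  a , b , c , d , ha , hb , hc , hd ,
  ℚ.<-trans p<q h₁ , ℚ.<-trans p<q h₂ , ℚ.<-trans p<q h₃ , ℚ.<-trans p<q h₄
(x *ᵣ y) .lower-open (a , b , c , d , ha , hb , hc , hd , h₁ , h₂ , h₃ , h₄)
  with glb h₁ h₂ | glb h₃ h₄
... | m , qm , m₁ , m₂ | n , qn , n₃ , n₄ with glb qm qn
... | k , qk , km , kn with dense qk
... | r , qr , rk = r , qr , a , b , c , d , ha , hb , hc , hd ,
  ℚ.<-≤-trans rk (ℚ.≤-trans km m₁) , ℚ.<-≤-trans rk (ℚ.≤-trans km m₂) ,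
  ℚ.<-≤-trans rk (ℚ.≤-trans kn n₃) , ℚ.<-≤-trans rk (ℚ.≤-trans kn n₄)
(x *ᵣ y) .upper-up p<q (a , b , c , d , ha , hb , hc , hd , h₁ , h₂ , h₃ , h₄) =
  a , b , c , d , ha , hb , hc , hd ,
  ℚ.<-trans h₁ p<q , ℚ.<-trans h₂ p<q , ℚ.<-trans h₃ p<q , ℚ.<-trans h₄ p<q
(x *ᵣ y) .upper-open (a , b , c , d , ha , hb , hc , hd , h₁ , h₂ , h₃ , h₄)
  with lub h₁ h₂ | lub h₃ h₄
... | m , qm , m₁ , m₂ | n , qn , n₃ , n₄ with lub qm qn
... | k , qk , km , kn with dense qk
... | r , kr , rq = r , rq , a , b , c , d , ha , hb , hc , hd ,
  ℚ.≤-<-trans (ℚ.≤-trans m₁ km) kr , ℚ.≤-<-trans (ℚ.≤-trans m₂ km) kr ,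
  ℚ.≤-<-trans (ℚ.≤-trans n₃ kn) kr , ℚ.≤-<-trans (ℚ.≤-trans n₄ kn) kr
(x *ᵣ y) .ordered (a , b , c , d , ha , hb , hc , hd , h₁ , h₂ , h₃ , h₄)
                  (a′ , b′ , c′ , d′ , ha′ , hb′ , hc′ , hd′ , h₁′ , h₂′ , h₃′ , h₄′)
  with maxL x ha ha′ | maxL y hc hc′
... | s , hs , as , a′s | t , ht , ct , c′t = ℚ.<-trans
  (corners as (ℚ.<⇒≤ (ordered x hs hb)) ct (ℚ.<⇒≤ (ordered y ht hd)) h₁ h₂ h₃ h₄)
  (corners′ a′s (ℚ.<⇒≤ (ordered x hs hb′)) c′t (ℚ.<⇒≤ (ordered y ht hd′)) h₁′ h₂′ h₃′ h₄′)
(x *ᵣ y) .located ε hε with third hε | located x 1ℚ 0<1 | located y 1ℚ 0<1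
... | η , hη , 2η<ε | a₀ , b₀ , ha₀ , hb₀ , _ | c₀ , d₀ , hc₀ , hd₀ , _ = result
  where
  open +-*-Solver
  K₁ = b₀ ⊔ (1ℚ - a₀)
  K₂ = (1ℚ + d₀) ⊔ (1ℚ - c₀)
  K = (K₁ ⊔ K₂) ⊔ 1ℚ

  K>0 : 0ℚ < K
  K>0 = ⊔-<ʳ (K₁ ⊔ K₂) 1ℚ 0<1

  bound₁ : ∀ {t} → t < K₁ → t < K
  bound₁ h = ⊔-<ˡ (K₁ ⊔ K₂) 1ℚ (⊔-<ˡ K₁ K₂ h)

  bound₂ : ∀ {t} → t < K₂ → t < K
  bound₂ h = ⊔-<ˡ (K₁ ⊔ K₂) 1ℚ (⊔-<ʳ K₁ K₂ h)

  flip : ∀ {t} → - t < K → - K < t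
  flip {t} h = undiff (subst (0ℚ <_) (solve 2 (λ t k → k :- (:- t) := t :- (:- k)) refl t K) (diff h))

  result : ∃₂ λ l u → Lower (x *ᵣ y) l × Upper (x *ᵣ y) u × u - l < ε
  result with shrink hη (pos++ K>0 K>0)
  ... | δ , δ>0 , δ<1 , hδ with located x δ δ>0 | located y δ δ>0
  ... | a , b , ha , hb , hx | c , d , hc , hd , hy =
      a * c - η , a * c + η
    , (a , b , c , d , ha , hb , hc , hd
      , below (solve 3 (λ a c e → e := a :* c :- (a :* c :- e)) refl a c η) hη
      , below (solve 5 (λ a c d e m → (e :- m) :+ (m :+ (d :- c) :* a) := a :* d :- (a :* c :- e) ) refl a c d η m)
          (pos++ m<η (proj₂ va))
      , below (solve 5 (λ a b c e m → (e :- m) :+ (m :+ (b :- a) :* c) := b :* c :- (a :* c :- e) ) refl a b c η m)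
          (pos++ m<η (proj₂ wc))
      , below (solve 6 (λ a b c d e m → (e :- (m :+ m)) :+ ((m :+ (d :- c) :* a) :+ (m :+ (b :- a) :* d)) := b :* d :- (a :* c :- e) ) refl a b c d η m)
          (pos++ 2m<η (pos++ (proj₂ va) (proj₂ wd))))
    , (a , b , c , d , ha , hb , hc , hd
      , below (solve 3 (λ a c e → e := (a :* c :+ e) :- a :* c) refl a c η) hη
      , below (solve 5 (λ a c d e m → (e :- m) :+ (m :- (d :- c) :* a) := (a :* c :+ e) :- a :* d) refl a c d η m)
          (pos++ m<η (proj₁ va))
      , below (solve 5 (λ a b c e m → (e :- m) :+ (m :- (b :- a) :* c) := (a :* c :+ e) :- b :* c) refl a b c η m)
          (pos++ m<η (proj₁ wc))
      , below (solve 6 (λ a b c d e m → (e :- (m :+ m)) :+ ((m :- (d :- c) :* a) :+ (m :- (b :- a) :* d)) := (a :* c :+ e) :- b :* d) refl a b c d η m)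
          (pos++ 2m<η (pos++ (proj₁ va) (proj₁ wd))))
    , subst (_< ε) (solve 3 (λ a c e → e :+ e := (a :* c :+ e) :- (a :* c :- e)) refl a c η) 2η<ε
    where
    below : ∀ {p q r} → r ≡ q - p → 0ℚ < r → p < q
    below eq h = undiff (subst (0ℚ <_) eq h)
    m = δ * K
    2m<η : 0ℚ < η - (m + m)
    2m<η = subst (λ z → 0ℚ < η - z) (ℚ.*-distribˡ-+ δ K K) (diff hδ)
    m<η : 0ℚ < η - m
    m<η = subst (0ℚ <_) (solve 2 (λ e m → (e :- (m :+ m)) :+ m := e :- m) refl η m)
            (pos++ 2m<η (pos* δ>0 K>0))
    a<K : a < K
    a<K = bound₁ (⊔-<ˡ b₀ (1ℚ - a₀) (ordered x ha hb₀))
    -K<a : - K < a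
    -K<a = flip (bound₁ (⊔-<ʳ b₀ (1ℚ - a₀) (below
      (solve 4 (λ a b a₀ d → (d :- (b :- a)) :+ ((b :- a₀) :+ (con 1ℚ :- d)) := (con 1ℚ :- a₀) :- (:- a)) refl a b a₀ δ)
      (pos++ (diff hx) (pos++ (diff (ordered x ha₀ hb)) (diff δ<1))))))
    c<K : c < K
    c<K = bound₂ (⊔-<ˡ (1ℚ + d₀) (1ℚ - c₀) (below
      (solve 2 (λ c d₀ → (d₀ :- c) :+ con 1ℚ := (con 1ℚ :+ d₀) :- c) refl c d₀)
      (pos++ (diff (ordered y hc hd₀)) 0<1)))
    -K<c : - K < c
    -K<c = flip (bound₂ (⊔-<ʳ (1ℚ + d₀) (1ℚ - c₀) (below
      (solve 4 (λ a b a₀ d → (d :- (b :- a)) :+ ((b :- a₀) :+ (con 1ℚ :- d)) := (con 1ℚ :- a₀) :- (:- a)) refl c d c₀ δ)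
      (pos++ (diff hy) (pos++ (diff (ordered y hc₀ hd)) (diff δ<1))))))
    d<K : d < K
    d<K = bound₂ (⊔-<ˡ (1ℚ + d₀) (1ℚ - c₀) (below
      (solve 4 (λ c d d₀ δ → (δ :- (d :- c)) :+ ((d₀ :- c) :+ (con 1ℚ :- δ)) := (con 1ℚ :+ d₀) :- d) refl c d d₀ δ)
      (pos++ (diff hy) (pos++ (diff (ordered y hc hd₀)) (diff δ<1)))))
    -K<d : - K < d
    -K<d = ℚ.<-trans -K<c (ordered y hc hd)
    va = small {t = a} (diff (ordered y hc hd)) hy -K<a a<K
    wc = small {t = c} (diff (ordered x ha hb)) hx -K<c c<K
    wd = small {t = d} (diff (ordered x ha hb)) hx -K<d d<K

-- For r < 0 this is the real number 0.
√_ : ℚ → ℝ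
(√ r) .Lower q = q < 0ℚ ⊎ q * q < r
(√ r) .Upper q = 0ℚ < q × r < q * q
(√ r) .lower-down {p} {q} p<q h with compare p 0ℚ | h
... | inj₁ p<0 | _ = inj₁ p<0
... | inj₂ p≥0 | inj₁ q<0 = inj₁ (ℚ.<-trans p<q q<0)
... | inj₂ p≥0 | inj₂ q²<r = inj₂ (ℚ.<-trans (sq-mono p≥0 p<q) q²<r)
(√ r) .lower-open {q} h with compare q 0ℚ | h
... | inj₁ q<0 | _ = let m , a , b = dense q<0 in m , a , inj₁ b
... | inj₂ q≥0 | inj₁ q<0 = ⊥-elim (ℚ.<-irrefl refl (ℚ.<-≤-trans q<0 q≥0))
... | inj₂ q≥0 | inj₂ q²<r with shrink (diff q²<r) (pos+ 0<1 (nn+ q≥0 q≥0))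
... | δ , δ>0 , δ<1 , h′ = q + δ
    , undiff (subst (0ℚ <_) (solve 2 (λ q d → d := (q :+ d) :- q) refl q δ) δ>0)
    , inj₂ (undiff (subst (0ℚ <_)
        (solve 3 (λ q d r → ((r :- q :* q) :- d :* (con 1ℚ :+ (q :+ q))) :+ d :* (con 1ℚ :- d)
                          := r :- (q :+ d) :* (q :+ d)) refl q δ r)
        (pos++ (diff h′) (pos* δ>0 (diff δ<1)))))
  where open +-*-Solver
(√ r) .upper-up p<q (p>0 , h) = ℚ.<-trans p>0 p<q , ℚ.<-trans h (sq-mono (ℚ.<⇒≤ p>0) p<q)
(√ r) .upper-open {q} (q>0 , h) with shrink (diff h) (pos++ (pos* q>0 q>0) (pos* q>0 q>0))
... | δ , δ>0 , δ<1 , h′ = q * (1ℚ - δ)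
    , undiff (subst (0ℚ <_) (solve 2 (λ q d → q :* d := q :- q :* (con 1ℚ :- d)) refl q δ) (pos* q>0 δ>0))
    , pos* q>0 (diff δ<1)
    , undiff (subst (0ℚ <_)
        (solve 3 (λ q d r → ((q :* q :- r) :- d :* (q :* q :+ q :* q)) :+ (q :* d) :* (q :* d)
                          := (q :* (con 1ℚ :- d)) :* (q :* (con 1ℚ :- d)) :- r) refl q δ r)
        (pos++ (diff h′) (pos* (pos* q>0 δ>0) (pos* q>0 δ>0))))
  where open +-*-Solver
(√ r) .ordered {l} {u} hl (u>0 , hu) with compare l u | hl
... | inj₁ l<u | _ = l<u
... | inj₂ u≤l | inj₁ l<0 = ℚ.<-trans l<0 u>0
... | inj₂ u≤l | inj₂ l²<r = ⊥-elim (ℚ.<-irrefl refl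
  (ℚ.<-trans l²<r (ℚ.<-≤-trans hu (sq-mono≤ (ℚ.<⇒≤ u>0) u≤l))))
(√ r) .located ε hε with third hε
... | δ , δ>0 , 2δ<ε = start
  where
  open +-*-Solver
  Close = ∃₂ λ l u → Lower (√ r) l × Upper (√ r) u × u - l < ε

  grid : ℕ → ℚ
  grid n = ι n * δ

  grid-suc : ∀ n → grid (suc n) ≡ δ + grid n
  grid-suc n = trans (cong (_* δ) (ι-suc n)) (solve 2 (λ n d → (con 1ℚ :+ n) :* d := d :+ n :* d) refl (ι n) δ)

  grid≥0 : ∀ n → 0ℚ ≤ grid n
  grid≥0 n = nn* (ι≥0 n) (ℚ.<⇒≤ δ>0)

  grid>0 : ∀ n → 0ℚ < grid (suc n)
  grid>0 n = subst (0ℚ <_) (sym (grid-suc n)) (pos+ δ>0 (grid≥0 n))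

  -- Lower the grid point grid n above √ r until the one below is no longer above.
  search : ∀ n → r < grid (suc n) * grid (suc n) → Close
  search zero h = - δ , grid 1
    , inj₁ (undiff (subst (0ℚ <_) (solve 1 (λ d → d := con 0ℚ :- (:- d)) refl δ) δ>0))
    , (grid>0 0 , h)
    , subst (_< ε) (trans (solve 1 (λ d → d :+ d := d :- (:- d)) refl δ)
        (cong (_- - δ) (sym (ℚ.*-identityˡ δ)))) 2δ<ε
  search (suc n) h with compare r (grid (suc n) * grid (suc n))
  ... | inj₁ h′ = search n h′
  ... | inj₂ h′ = grid n , grid (suc (suc n))
    , inj₂ (ℚ.<-≤-trans (sq-mono (grid≥0 n) lt) h′)
    , (grid>0 (suc n) , h)
    , subst (_< ε) (trans (solve 2 (λ d m → d :+ d := (d :+ (d :+ m)) :- m) refl δ (grid n))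
        (cong (_- grid n) (sym (trans (grid-suc (suc n)) (cong (λ z → δ + z) (grid-suc n)))))) 2δ<ε
    where
    lt : grid n < grid (suc n)
    lt = undiff (subst (0ℚ <_) (trans (solve 2 (λ d m → d := (d :+ m) :- m) refl δ (grid n))
      (cong (_- grid n) (sym (grid-suc n)))) δ>0)

  start : Close
  start with archimedean (r ⊔ 1ℚ) δ>0
  ... | zero , h = ⊥-elim (ℚ.<-irrefl refl (ℚ.<-trans 0<1
      (ℚ.≤-<-trans (ℚ.p≤q⊔p r 1ℚ) (subst (r ⊔ 1ℚ <_) (ℚ.*-zeroˡ δ) h))))
  ... | suc n , h = search n (ℚ.<-trans (ℚ.≤-<-trans (ℚ.p≤p⊔q r 1ℚ) h)
      (undiff (subst (0ℚ <_) (solve 1 (λ m → m :* (m :- con 1ℚ) := m :* m :- m) refl (grid (suc n)))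
        (pos* (grid>0 n) (diff (ℚ.≤-<-trans (ℚ.p≤q⊔p r 1ℚ) h))))))

_^-½ : (m : ℕ) .{{_ : ℕ.NonZero m}} → ℝ
m ^-½ = √ (+ 1 ℚ./ m)

{-# OPTIONS --safe #-}

-- Put N = n − x = φ(n) + R and t = kR − 1, so that ed − kφ(n) = 1 reads
-- kN = ed + t. From q < p < 2q follows 2(p + q)² < 9n, hence
-- √(2/3) n − √(3n) < √(2/3) φ(n), and the bound on d becomes 3dt < 2N: the
-- fraction k/d approximates e/N closely from above. The Euclidean algorithm on
-- (N, e) carries two vectors u = (d₁, t₁) and v = (d₂, −t₂) with
-- t₁d₂ + t₂d₁ = N, and (d, t) = a u + b v with a and b coprime. Reducing v by u
-- keeps a positive because t ≥ 0; reducing u by v keeps b nonnegative because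
-- otherwise 3dt ≥ 2N, except when a = b = 1. So d turns up as d₁ + d₂ or as d₁
-- within O(log N) rounds. Each candidate for d determines k = ⌈ed/N⌉,
-- φ(n) = (ed − 1)/k and p + q = n + 1 − φ(n), and then q by bisection; the
-- outcome is kept only if it is a factor of n.
module Submission where

open import Defs
open import Data.Bool.Base using (Bool; true; false; T; _∧_; if_then_else_)
open import Data.Bool.Properties using (T-∧)
open import Data.Integer.Base as ℤ using (ℤ; +_; -[1+_]; 1ℤ)
import Data.Integer.Properties as ℤ
open import Data.List.Base using ([]; _∷_; filter; length; applyUpTo)
open import Data.List.Properties using (map-upTo)
open import Data.Maybe.Base using (Maybe; just; nothing; fromMaybe; is-just; zipWith)
open import Data.Nat.Base
  using (ℕ; zero; suc; _+_; _*_; _∸_; _^_; _⊔_; _≤_; _<_; z≤n; s≤s; z<s; s<s; _≤ᵇ_; _<ᵇ_; _≡ᵇ_;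
    ⌊_/2⌋; ⌈_/2⌉; NonZero; >-nonZero; ≢-nonZero; ≢-nonZero⁻¹; nonTrivial⇒n>1)
open import Data.Nat.Coprimality using (Coprime; coprime?; coprime-divisor)
open import Data.Nat.Divisibility
open import Data.Nat.DivMod
  using (m≡m%n+[m/n]*n; m%n<n; m%n≤m; m/n≤m; +-distrib-/-∣ʳ; m<n⇒m/n≡0; m*n/n≡m)
open import Data.Nat.Induction using (<-wellFounded)
open import Data.Nat.Logarithm
open import Data.Nat.Primality
  using (Prime; euclidsLemma; prime⇒irreducible; prime⇒nonZero; prime⇒nonTrivial)
open import Data.Nat.Properties
open import Data.Nat.Tactic.RingSolver using (solve-∀)
open import Data.Product.Base using (∃; ∃₂; Σ-syntax; ∃-syntax; _×_; _,_; proj₁; proj₂)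
open import Data.Rational.Base as ℚ using (ℚ; 0ℚ; 1ℚ; _/_)
import Data.Rational.Properties as ℚ
import Data.Rational.Solver as ℚ
import Data.Rational.Unnormalised.Base as ℚᵘ
import Data.Rational.Unnormalised.Properties as ℚᵘ
open import Data.Sum.Base as Sum using (_⊎_; inj₁; inj₂; [_,_]′)
open import Data.Unit.Base using (tt)
open import Function.Base using (_∘_; id)
open import Function.Bundles using (Equivalence)
open import Induction.WellFounded using (Acc; acc)
open import Level using (0ℓ)
open import Relation.Binary.PropositionalEquality
  using (_≡_; _≢_; refl; sym; trans; cong; cong₂; subst; subst₂; module ≡-Reasoning)
open import Relation.Nullary.Decidable.Core using (Dec; yes; no; does)
open import Relation.Nullary.Negation using (¬_; contradiction)
open import Relation.Unary using (Decidable; Pred)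

-- The time must be bounded through `e` and `n` alone, although `x` is part of the input. The bound
-- on `d` itself supplies this: as `e` and `d` are at least 1, it forces `R < φ(n)²`, so `N` and the
-- absolute value of `x` stay below a polynomial in `e n`. The machine cannot recognise `d`, so
-- wrong candidates run through the whole procedure. Size and time invariants therefore hold for
-- every candidate, correctness invariants only under the assumption that the candidate is right,
-- and the final test is passed by `q` alone, so a later wrong candidate cannot spoil the result. In
-- terms of fractions, `3dt < 2N` says `k/d − e/N < 2/(3d²)`, weaker than the `1/(2d²)` of
-- Legendre's criterion. With `1/2` for `2/3` the inequality behind `no-overshoot` would hold for
-- `a = b = 1` too; the extra candidate `d₁ + d₂` is the price of the larger constant.

n≤2^⌈log₂n⌉ : ∀ n → n ≤ 2 ^ ⌈log₂ n ⌉
n≤2^⌈log₂n⌉ n = go n (<-wellFounded n)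
  where
  go : ∀ n → Acc _<_ n → n ≤ 2 ^ ⌈log₂ n ⌉
  go 0 _ = z≤n
  go 1 _ = ≤-refl
  go n@(suc (suc n-2)) (acc rec) = begin
    n                            ≡⟨ ⌊n/2⌋+⌈n/2⌉≡n n ⟨
    ⌊ n /2⌋ + half               ≤⟨ +-monoˡ-≤ half (⌊n/2⌋≤⌈n/2⌉ n) ⟩
    half + half                  ≤⟨ +-mono-≤ ih ih ⟩
    2 ^ k + 2 ^ k                ≡⟨ cong (_+_ (2 ^ k)) (+-identityʳ (2 ^ k)) ⟨
    -- This undoes the truncated `∸ 1` in `k`: since `n ≥ 2`, its logarithm is at least 1.
    2 ^ suc k                    ≡⟨ cong (2 ^_) (m+[n∸m]≡n {1} (⌈log₂⌉-mono-≤ {2} {n} (s≤s (s≤s z≤n)))) ⟩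
    2 ^ ⌈log₂ n ⌉                ∎
    where
    open ≤-Reasoning
    half = ⌈ n /2⌉
    k = ⌈log₂ n ⌉ ∸ 1
    ih : half ≤ 2 ^ k
    ih = subst (λ z → half ≤ 2 ^ z) (⌈log₂⌈n/2⌉⌉≡⌈log₂n⌉∸1 n) (go half (rec (⌈n/2⌉<n n-2)))

bits≤ : ∀ {x m} → x < 2 ^ m → bits x ≤ m
bits≤ {x} {m} h = subst (bits x ≤_) (⌈log₂2^n⌉≡n m) (⌈log₂⌉-mono-≤ h)

quot≤ : ∀ x y → apply quot x y ≤ x
quot≤ x zero    = z≤n
quot≤ x (suc y) = m/n≤m x (suc y)

rem≤ : ∀ x y → apply rem x y ≤ x
rem≤ x zero    = ≤-refl
rem≤ x (suc y) = m%n≤m x (suc y)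

n<2^n : ∀ n → n < 2 ^ n
n<2^n zero    = z<s
n<2^n (suc n) = begin-strict
  suc n            ≤⟨ n<2^n n ⟩
  2 ^ n            <⟨ m<m+n (2 ^ n) (m^n>0 2 n) ⟩
  2 ^ n + 2 ^ n    ≡⟨ cong (_+_ (2 ^ n)) (+-identityʳ (2 ^ n)) ⟨
  2 ^ suc n        ∎
  where open ≤-Reasoning

-- One product bound for all five operations lets the static analysis charge an instruction without
-- looking at its operation.
cost≤ : ∀ o x y → cost o x y ≤ suc (bits x) * suc (bits y)
cost≤ add   x y = s≤s (≤-trans (+-monoʳ-≤ (bits x) (m≤m*n (bits y) 1)) (begin
  bits x + bits y * 1 ≤⟨ +-monoʳ-≤ (bits x) (≤-reflexive (*-identityʳ (bits y))) ⟩
  bits x + bits y ≡⟨ +-comm (bits x) (bits y) ⟩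
  bits y + bits x ≤⟨ +-monoʳ-≤ (bits y) (m≤m*n (bits x) (suc (bits y))) ⟩
  bits y + bits x * suc (bits y) ∎))
  where open ≤-Reasoning
cost≤ monus x y = cost≤ add x y
cost≤ mul   x y = ≤-refl
cost≤ quot  x y = ≤-refl
cost≤ rem   x y = ≤-refl

-- Hoare triples

record Runs (P : Program) (σ : State) (c : ℕ) (Post : State → Set) : Set where
  constructor runs
  field
    {final} : State
    {time}  : ℕ
    steps   : P , σ ⇓ final [ time ]
    time≤   : time ≤ c
    post    : Post final

runs-weaken : ∀ {P σ c c′} {Post Post′ : State → Set} → c ≤ c′ → (∀ {τ} → Post τ → Post′ τ) →
  Runs P σ c Post → Runs P σ c′ Post′
runs-weaken c≤ f (runs s t p) = runs s (≤-trans t c≤) (f p)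

runs-seq : ∀ {P Q σ c c′} {Mid Post : State → Set} →
  Runs P σ c Mid → (∀ {τ} → Mid τ → Runs Q τ c′ Post) → Runs (P ⨾ Q) σ (c + c′) Post
runs-seq (runs s t p) k with k p
... | runs s′ t′ p′ = runs (seq s s′) (+-mono-≤ t t′) p′

-- Whether a program writes only to registers b and above.
above : ℕ → Program → Bool
above b skip                = true
above b (r ≔ _)             = b ≤ᵇ r
above b (r ≔ _ ⟨ _ ⟩ _)     = b ≤ᵇ r
above b (P ⨾ Q)             = above b P ∧ above b Q
above b (ifNonZero _ P Q)   = above b P ∧ above b Q
above b (whileNonZero _ P)  = above b P

private
  update-other : ∀ {b r s} σ v → T (b ≤ᵇ r) → s < b → (σ [ r ↦ v ]) s ≡ σ s
  update-other {b} {r} {s} σ v b≤r s<b with s ≡ᵇ r in eq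
  ... | false = refl
  ... | true  = contradiction (≡ᵇ⇒≡ s r (subst T (sym eq) tt))
                  (<⇒≢ (<-≤-trans s<b (≤ᵇ⇒≤ b r b≤r)))

  T-left : ∀ {x y} → T (x ∧ y) → T x
  T-left {x} {y} h = proj₁ (Equivalence.to (T-∧ {x} {y}) h)

  T-right : ∀ {x y} → T (x ∧ y) → T y
  T-right {x} {y} h = proj₂ (Equivalence.to (T-∧ {x} {y}) h)

preserved : ∀ {b P σ τ t} → P , σ ⇓ τ [ t ] → T (above b P) → ∀ {s} → s < b → τ s ≡ σ s
preserved skip h s<b = refl
preserved {b} {σ = σ} (literal {r = r} {c}) h s<b = update-other {b} {r} σ c h s<b
preserved {b} {σ = σ} (operate {r = r}) h s<b = update-other {b} {r} σ _ h s<b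
preserved {b} (seq {P} {Q} s s′) h s<b =
  trans (preserved s′ (T-right {above b P} h) s<b) (preserved s (T-left {above b P} h) s<b)
preserved {b} (if-true {P = P} _ s) h s<b = preserved s (T-left {above b P} h) s<b
preserved {b} (if-false {P = P} _ s) h s<b = preserved s (T-right {above b P} h) s<b
preserved (while-true _ s s′) h s<b = trans (preserved s′ h s<b) (preserved s h s<b)
preserved (while-false _) h s<b = refl

-- The bound on `s` is a Boolean test: for a concrete register it reduces to the unit type and is
-- filled in by unification.
Agree : ℕ → State → State → Set
Agree b σ τ = ∀ s → {T (s <ᵇ b)} → τ s ≡ σ s

runs-preserving : ∀ b {P σ c Post} → {T (above b P)} → Runs P σ c Post →
  Runs P σ c (λ τ → Post τ × Agree b σ τ)
runs-preserving b {_} {_} {_} {_} {h} (runs s t p) =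
  runs s t (p , λ r {r<b} → preserved s h (<ᵇ⇒< r b r<b))

-- Static analysis of programs without loops

-- α r ≡ just k asserts that register r holds a number below 2 ^ (L * k),
-- where L is the parameter of Within; nothing asserts nothing.
Sizes : Set
Sizes = Reg → Maybe ℕ

infixl 5 _⟪_↦_⟫

∅ : Sizes
∅ _ = nothing

_⟪_↦_⟫ : Sizes → Reg → ℕ → Sizes
(α ⟪ r ↦ k ⟫) s = if s ≡ᵇ r then just k else α s

size : Sizes → Reg → ℕ
size α r = fromMaybe 0 (α r)

known : Sizes → Reg → Bool
known α r = is-just (α r)

-- Sizes count blocks of `L` bits. The extra block for `add` absorbs the carry, as `L ≥ 1`; `monus`,
-- `quot` and `rem` never exceed their first operand.
opSize : Op → ℕ → ℕ → ℕ
opSize add j k = suc (j + k)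
opSize mul j k = j + k
opSize _   j k = j

-- The clause for loops is a dummy value: `analysable` rejects loops, so `runs-exec` identifies
-- `exec` with the true semantics only on loop-free code.
exec : Program → State → State
exec skip σ                 = σ
exec (r ≔ c) σ              = σ [ r ↦ c ]
exec (r ≔ s ⟨ o ⟩ u) σ      = σ [ r ↦ apply o (σ s) (σ u) ]
exec (P ⨾ Q) σ              = exec Q (exec P σ)
exec (ifNonZero r P Q) σ with σ r
... | zero  = exec Q σ
... | suc _ = exec P σ
exec (whileNonZero _ _) σ   = σ

resize : Program → Sizes → Sizes
resize skip α               = α
resize (r ≔ c) α            = α ⟪ r ↦ c ⟫
resize (r ≔ s ⟨ o ⟩ u) α    = α ⟪ r ↦ opSize o (size α s) (size α u) ⟫
resize (P ⨾ Q) α            = resize Q (resize P α)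
resize (ifNonZero r P Q) α  = λ s → zipWith _⊔_ (resize P α s) (resize Q α s)
resize (whileNonZero _ _) α = ∅

analysable : Program → Sizes → Bool
analysable skip α               = true
analysable (r ≔ c) α            = true
analysable (r ≔ s ⟨ o ⟩ u) α    = known α s ∧ known α u
analysable (P ⨾ Q) α            = analysable P α ∧ analysable Q (resize P α)
analysable (ifNonZero r P Q) α  = known α r ∧ analysable P α ∧ analysable Q α
analysable (whileNonZero _ _) α = false

-- The running time in units of L ^ 2.
weight : Program → Sizes → ℕ
weight skip α               = 0
weight (r ≔ c) α            = suc c
weight (r ≔ s ⟨ o ⟩ u) α    = suc (size α s) * suc (size α u)
weight (P ⨾ Q) α            = weight P α + weight Q (resize P α)
weight (ifNonZero r P Q) α  = suc (size α r) + (weight P α + weight Q α)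
weight (whileNonZero _ _) α = 0

exec-if : ∀ r P Q σ (Post : State → Set) → (σ r ≢ 0 → Post (exec P σ)) →
  (σ r ≡ 0 → Post (exec Q σ)) → Post (exec (ifNonZero r P Q) σ)
exec-if r P Q σ Post f g with σ r
... | zero  = g refl
... | suc _ = f λ ()

-- Soundness of the size analysis, and running times as multiples of powers of `L`

module Bounded (L : ℕ) (1≤L : 1 ≤ L) where

  record Within (α : Sizes) (σ : State) : Set where
    constructor within
    field bound : ∀ r {k} → α r ≡ just k → σ r < 2 ^ (L * k)

  open Within public

  2^L-mono : ∀ {j k} → j ≤ k → 2 ^ (L * j) ≤ 2 ^ (L * k)
  2^L-mono j≤k = ^-monoʳ-≤ 2 (*-monoʳ-≤ L j≤k)

  within-∅ : ∀ {σ} → Within ∅ σ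
  within-∅ = within λ r ()

  infixl 5 _▸[_↦_]_

  _▸[_↦_]_ : ∀ {α σ} → Within α σ → ∀ r k → σ r < 2 ^ (L * k) → Within (α ⟪ r ↦ k ⟫) σ
  _▸[_↦_]_ {α} {σ} w r k h = within go
    where
    go : ∀ s {j} → (α ⟪ r ↦ k ⟫) s ≡ just j → σ s < 2 ^ (L * j)
    go s eq with s ≡ᵇ r in s≡r
    ... | false = bound w s eq
    ... | true with refl ← eq = subst (λ z → σ z < 2 ^ (L * k)) (sym (≡ᵇ⇒≡ s r (subst T (sym s≡r) tt))) h

  within-update : ∀ {α σ v k} r → Within α σ → v < 2 ^ (L * k) → Within (α ⟪ r ↦ k ⟫) (σ [ r ↦ v ])
  within-update {α} {σ} {v} {k} r w h = within go
    where
    go : ∀ s {j} → (α ⟪ r ↦ k ⟫) s ≡ just j → (σ [ r ↦ v ]) s < 2 ^ (L * j)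
    go s eq with s ≡ᵇ r
    ... | false = bound w s eq
    ... | true with refl ← eq = h

  -- A literal serves as its own size: this is wasteful but independent of `L`, which keeps `weight`
  -- a constant.
  literal< : ∀ c → c < 2 ^ (L * c)
  literal< c = <-≤-trans (n<2^n c) (^-monoʳ-≤ 2 (m≤n*m c L {{>-nonZero 1≤L}}))

  apply< : ∀ o {x y j k} → x < 2 ^ (L * j) → y < 2 ^ (L * k) → apply o x y < 2 ^ (L * opSize o j k)
  apply< add {x} {y} {j} {k} hx hy = begin-strict
    x + y                              <⟨ +-mono-< hx hy ⟩
    2 ^ (L * j) + 2 ^ (L * k)          ≤⟨ +-mono-≤ (2^L-mono (m≤m+n j k)) (2^L-mono (m≤n+m k j)) ⟩
    V + V                              ≡⟨ cong (_+_ V) (+-identityʳ V) ⟨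
    2 ^ suc (L * (j + k))              ≤⟨ ^-monoʳ-≤ 2 (+-monoˡ-≤ (L * (j + k)) 1≤L) ⟩
    2 ^ (L + L * (j + k))              ≡⟨ cong (2 ^_) (*-suc L (j + k)) ⟨
    2 ^ (L * suc (j + k))              ∎
    where
    open ≤-Reasoning
    V = 2 ^ (L * (j + k))
  apply< monus {x} {y} hx hy = ≤-<-trans (m∸n≤m x y) hx
  apply< mul {x} {y} {j} {k} hx hy = begin-strict
    x * y                     <⟨ *-mono-< hx hy ⟩
    2 ^ (L * j) * 2 ^ (L * k) ≡⟨ ^-distribˡ-+-* 2 (L * j) (L * k) ⟨
    2 ^ (L * j + L * k)       ≡⟨ cong (2 ^_) (*-distribˡ-+ L j k) ⟨
    2 ^ (L * (j + k))         ∎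
    where open ≤-Reasoning
  apply< quot {x} {y} hx hy = ≤-<-trans (quot≤ x y) hx
  apply< rem {x} {y} hx hy = ≤-<-trans (rem≤ x y) hx

  1+L*≤ : ∀ k → suc (L * k) ≤ suc k * L
  1+L*≤ k = ≤-trans (+-monoˡ-≤ (L * k) 1≤L) (≤-reflexive (cong (_+_ L) (*-comm L k)))

  1+bits≤ : ∀ {x k} → x < 2 ^ (L * k) → suc (bits x) ≤ suc k * L
  1+bits≤ {x} {k} h = ≤-trans (s≤s (bits≤ h)) (1+L*≤ k)

  ≤-*L : ∀ x → x ≤ x * L
  ≤-*L x = m≤m*n x L {{>-nonZero 1≤L}}

  1+bits≤L² : ∀ {x k} → x < 2 ^ (L * k) → suc (bits x) ≤ suc k * (L * L)
  1+bits≤L² {x} {k} h = ≤-trans (1+bits≤ h) (*-monoʳ-≤ (suc k) (≤-*L L))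

  private
    operand : ∀ {α σ} → Within α σ → ∀ r → T (known α r) → σ r < 2 ^ (L * size α r)
    operand {α} w r h with α r in eq
    ... | just k = bound w r eq

    zipWith-inv : ∀ a b {k} → zipWith _⊔_ a b ≡ just k →
      ∃₂ λ i j → a ≡ just i × b ≡ just j × i ≤ k × j ≤ k
    zipWith-inv (just i) (just j) refl = i , j , refl , refl , m≤m⊔n i j , m≤n⊔m i j

    joinˡ : ∀ (α β : Sizes) {σ} → Within α σ → Within (λ s → zipWith _⊔_ (α s) (β s)) σ
    joinˡ α β {σ} w = within go
      where
      go : ∀ r {k} → zipWith _⊔_ (α r) (β r) ≡ just k → σ r < 2 ^ (L * k)
      go r eq with zipWith-inv (α r) (β r) eq
      ... | _ , _ , p , _ , i≤k , _ = <-≤-trans (bound w r p) (2^L-mono i≤k)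

    joinʳ : ∀ (α β : Sizes) {σ} → Within β σ → Within (λ s → zipWith _⊔_ (α s) (β s)) σ
    joinʳ α β {σ} w = within go
      where
      go : ∀ r {k} → zipWith _⊔_ (α r) (β r) ≡ just k → σ r < 2 ^ (L * k)
      go r eq with zipWith-inv (α r) (β r) eq
      ... | _ , _ , _ , p , _ , j≤k = <-≤-trans (bound w r p) (2^L-mono j≤k)

    branch≤ : ∀ {x k a t} b → x < 2 ^ (L * k) → a ≤ b → t ≤ a * (L * L) →
      suc (bits x) + t ≤ (suc k + b) * (L * L)
    branch≤ {k = k} b h a≤b t≤ = ≤-trans
      (+-mono-≤ (1+bits≤L² h) (≤-trans t≤ (*-monoˡ-≤ (L * L) a≤b)))
      (≤-reflexive (sym (*-distribʳ-+ (L * L) (suc k) b)))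

  -- Sizes and weights are read off from the program text and do not involve `L`. This is why the
  -- weight of a fixed program can become a coefficient of the time polynomial.
  runs-exec : ∀ P {α σ} → {T (analysable P α)} → Within α σ →
    Runs P σ (weight P α * L ^ 2) (λ τ → τ ≡ exec P σ × Within (resize P α) τ)
  runs-exec P {α} {σ} {h} w = runs-weaken
    (≤-reflexive (cong (λ z → weight P α * (L * z)) (sym (*-identityʳ L)))) id (go P h w)
    where
    go : ∀ P {α σ} → T (analysable P α) → Within α σ →
      Runs P σ (weight P α * (L * L)) (λ τ → τ ≡ exec P σ × Within (resize P α) τ)
    go skip h w = runs skip z≤n (refl , w)
    go (r ≔ c) h w = runs literal (1+bits≤L² {k = c} (literal< c))
      (refl , within-update r w (literal< c))
    go (r ≔ s ⟨ o ⟩ u) {α} {σ} h w = runs operate time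
      (refl , within-update r w (apply< o hs hu))
      where
      hs = operand w s (T-left {known α s} h)
      hu = operand w u (T-right {known α s} h)
      open ≤-Reasoning
      time = begin
        cost o (σ s) (σ u)                                 ≤⟨ cost≤ o (σ s) (σ u) ⟩
        suc (bits (σ s)) * suc (bits (σ u))                ≤⟨ *-mono-≤ (1+bits≤ {k = size α s} hs) (1+bits≤ {k = size α u} hu) ⟩
        (suc (size α s) * L) * (suc (size α u) * L)        ≡⟨ rearrange (suc (size α s)) (suc (size α u)) L ⟩
        suc (size α s) * suc (size α u) * (L * L)          ∎
        where
        rearrange : ∀ a b l → (a * l) * (b * l) ≡ a * b * (l * l)
        rearrange = solve-∀
    go (P ⨾ Q) {α} h w = runs-weaken
      (≤-reflexive (sym (*-distribʳ-+ (L * L) (weight P α) _))) id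
      (runs-seq (go P (T-left {analysable P α} h) w)
        λ { (refl , w′) → go Q (T-right {analysable P α} h) w′ })
    go (ifNonZero r P Q) {α} {σ} h w = if-case (σ r) refl
      where
      p = weight P α
      q = weight Q α
      hr : σ r < 2 ^ (L * size α r)
      hr = operand w r (T-left {known α r} h)
      hPQ : T (analysable P α ∧ analysable Q α)
      hPQ = T-right {known α r} h
      Goal = λ τ → τ ≡ exec (ifNonZero r P Q) σ × Within (resize (ifNonZero r P Q) α) τ

      if-case : ∀ v → σ r ≡ v → Runs (ifNonZero r P Q) σ (weight (ifNonZero r P Q) α * (L * L)) Goal
      if-case zero eq with go Q (T-right {analysable P α} hPQ) w
      ... | runs s t (refl , w′) = runs (if-false eq s) (branch≤ (p + q) hr (m≤n+m q p) t)
        (exec-if r P Q σ (exec Q σ ≡_) (λ nz → contradiction eq nz) (λ _ → refl)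
        , joinʳ (resize P α) (resize Q α) w′)
      if-case (suc _) eq with go P (T-left {analysable P α} hPQ) w
      ... | runs s t (refl , w′) = runs (if-true nonzero s) (branch≤ (p + q) hr (m≤m+n p q) t)
        (exec-if r P Q σ (exec P σ ≡_) (λ _ → refl) (λ z → contradiction z nonzero)
        , joinˡ (resize P α) (resize Q α) w′)
        where
        nonzero : σ r ≢ 0
        nonzero z = 1+n≢0 (trans (sym eq) z)

  -- The index `m` of the invariant bounds the bits left in the guard register and drops in every
  -- round, so there are at most `L * k` rounds and a loop raises the power of `L` by one. The body
  -- has exponent at least 1 so that reading the guard, `suc (L * k)` operations, is absorbed.
  runs-while : ∀ {r P} κ j k (Inv : ℕ → State → Set) →
    (∀ {m σ} → Inv m σ → σ r < 2 ^ m) →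
    (∀ {m σ} → suc m ≤ L * k → Inv (suc m) σ → σ r ≢ 0 → Runs P σ (κ * L ^ suc j) (Inv m)) →
    ∀ {σ} → Inv (L * k) σ →
    Runs (whileNonZero r P) σ ((k * (suc k + κ) + suc k) * L ^ suc (suc j))
      (λ τ → ∃ λ m → m ≤ L * k × Inv m τ × τ r ≡ 0)
  runs-while {r} {P} κ j k Inv small body {σ} inv = runs-weaken total id (go (L * k) ≤-refl inv)
    where
    U = L ^ suc j
    c = suc k * U

    guard : suc (L * k) ≤ c
    guard = ≤-trans (1+L*≤ k) (*-monoʳ-≤ (suc k) (m≤m*n L (L ^ j) {{m^n≢0 L j {{>-nonZero 1≤L}}}}))

    total : (L * k) * (c + κ * U) + c ≤ (k * (suc k + κ) + suc k) * L ^ suc (suc j)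
    total = begin
      (L * k) * (suc k * U + κ * U) + suc k * U      ≤⟨ +-monoʳ-≤ ((L * k) * (suc k * U + κ * U)) (*-monoʳ-≤ (suc k) (m≤n*m U L {{>-nonZero 1≤L}})) ⟩
      (L * k) * (suc k * U + κ * U) + suc k * (L * U) ≡⟨ rearrange L k κ U ⟩
      (k * (suc k + κ) + suc k) * (L * U) ∎
      where
      open ≤-Reasoning
      rearrange : ∀ L k κ U → (L * k) * ((1 + k) * U + κ * U) + (1 + k) * (L * U) ≡ (k * ((1 + k) + κ) + (1 + k)) * (L * U)
      rearrange = solve-∀

    go : ∀ m → m ≤ L * k → ∀ {σ} → Inv m σ → Runs (whileNonZero r P) σ (m * (c + κ * U) + c)
      (λ τ → ∃ λ m → m ≤ L * k × Inv m τ × τ r ≡ 0)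
    go m m≤ {σ} inv with σ r ≟ 0
    ... | yes z = runs (while-false z) (≤-trans (s≤s (≤-trans (bits≤ (small inv)) m≤)) (≤-trans guard (m≤n+m c (m * (c + κ * U))))) (m , m≤ , inv , z)
    go zero m≤ inv | no nz = contradiction (n<1⇒n≡0 (small inv)) nz
    go (suc m) m≤ {σ} inv | no nz with body m≤ inv nz
    ... | runs s t p with go m (<⇒≤ m≤) p
    ...   | runs s′ t′ p′ = runs (while-true nz s s′) (begin
      suc (bits (σ r)) + _ + _ ≤⟨ +-mono-≤ (+-mono-≤ (≤-trans (s≤s (≤-trans (bits≤ (small inv)) m≤)) guard) t) t′ ⟩
      c + κ * U + (m * (c + κ * U) + c) ≡⟨ +-assoc (c + κ * U) (m * (c + κ * U)) c ⟨
      suc m * (c + κ * U) + c ∎) p′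
      where open ≤-Reasoning

-- The totient of a product of two primes

∑ : (ℕ → ℕ) → ℕ → ℕ
∑ f zero    = 0
∑ f (suc n) = f 0 + ∑ (f ∘ suc) n

∑-cong : ∀ {f g} n → (∀ i → i < n → f i ≡ g i) → ∑ f n ≡ ∑ g n
∑-cong zero    h = refl
∑-cong (suc n) h = cong₂ _+_ (h 0 z<s) (∑-cong n λ i i<n → h (suc i) (s<s i<n))

∑-split : ∀ f a b → ∑ f (a + b) ≡ ∑ f a + ∑ (λ i → f (a + i)) b
∑-split f zero    b = refl
∑-split f (suc a) b = trans (cong (_+_ (f 0)) (∑-split (f ∘ suc) a b))
  (sym (+-assoc (f 0) (∑ (f ∘ suc) a) _))

∑-const : ∀ c n → ∑ (λ _ → c) n ≡ n * c
∑-const c zero    = refl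
∑-const c (suc n) = cong (_+_ c) (∑-const c n)

∑-+ : ∀ f g n → ∑ (λ i → f i + g i) n ≡ ∑ f n + ∑ g n
∑-+ f g zero    = refl
∑-+ f g (suc n) = trans (cong (_+_ (f 0 + g 0)) (∑-+ (f ∘ suc) (g ∘ suc) n))
  (interchange (f 0) (g 0) (∑ (f ∘ suc) n) (∑ (g ∘ suc) n))
  where
  interchange : ∀ a b c d → a + b + (c + d) ≡ a + c + (b + d)
  interchange = solve-∀

[_] : ∀ {p} {P : Set p} → Dec P → ℕ
[ P? ] = if does P? then 1 else 0

[yes] : ∀ {p} {P : Set p} (P? : Dec P) → P → [ P? ] ≡ 1
[yes] (yes _) p = refl
[yes] (no ¬p) p = contradiction p ¬p

[no] : ∀ {p} {P : Set p} (P? : Dec P) → ¬ P → [ P? ] ≡ 0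
[no] (yes p) ¬p = contradiction p ¬p
[no] (no _)  ¬p = refl

[cong] : ∀ {p q} {P : Set p} {Q : Set q} (P? : Dec P) (Q? : Dec Q) → (P → Q) → (Q → P) → [ P? ] ≡ [ Q? ]
[cong] (yes p) Q? f g = sym ([yes] Q? (f p))
[cong] (no ¬p) Q? f g = sym ([no] Q? (¬p ∘ g))

-- This is the indicator identity `[C] = 1 − [P] − [Q] + [P and Q]` without subtraction; the last
-- three maps make `R` the conjunction of `P` and `Q`.
inclusion-exclusion : ∀ {p q r c} {P : Set p} {Q : Set q} {R : Set r} {C : Set c}
  (C? : Dec C) (P? : Dec P) (Q? : Dec Q) (R? : Dec R) →
  (P → ¬ C) → (Q → ¬ C) → (¬ P → ¬ Q → C) → (P → Q → R) → (R → P) → (R → Q) →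
  [ C? ] + ([ P? ] + [ Q? ]) ≡ 1 + [ R? ]
inclusion-exclusion C? (yes p) (yes q) R? f g h k u v = trans
  (cong (_+ 2) ([no] C? (f p))) (cong suc (sym ([yes] R? (k p q))))
inclusion-exclusion C? (yes p) (no ¬q) R? f g h k u v = trans
  (cong (_+ 1) ([no] C? (f p))) (cong suc (sym ([no] R? (¬q ∘ v))))
inclusion-exclusion C? (no ¬p) (yes q) R? f g h k u v = trans
  (cong (_+ 1) ([no] C? (g q))) (cong suc (sym ([no] R? (¬p ∘ u))))
inclusion-exclusion C? (no ¬p) (no ¬q) R? f g h k u v = trans
  (cong (_+ 0) ([yes] C? (h ¬p ¬q))) (cong suc (sym ([no] R? (¬p ∘ u))))

length-filter-applyUpTo : ∀ {P : Pred ℕ 0ℓ} (P? : Decidable P) f n →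
  length (filter P? (applyUpTo f n)) ≡ ∑ (λ i → [ P? (f i) ]) n
length-filter-applyUpTo P? f zero = refl
length-filter-applyUpTo P? f (suc n) with P? (f 0)
... | yes _ = cong suc (length-filter-applyUpTo P? (f ∘ suc) n)
... | no  _ = length-filter-applyUpTo P? (f ∘ suc) n

φ≡∑ : ∀ n → φ n ≡ ∑ (λ i → [ coprime? (suc i) n ]) n
φ≡∑ n = trans (cong (length ∘ filter (λ k → coprime? k n)) (map-upTo suc n))
  (length-filter-applyUpTo (λ k → coprime? k n) suc n)

-- Divisibility by `m` is periodic, and the block from 1 to `m` contains a single multiple, its last
-- element.
∑-multiples : ∀ m .{{_ : NonZero m}} j → ∑ (λ i → [ m ∣? suc i ]) (j * m) ≡ j
∑-multiples m@(suc m-1) zero = refl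
∑-multiples m@(suc m-1) (suc j) = begin
  ∑ f (m + j * m)                             ≡⟨ ∑-split f m (j * m) ⟩
  ∑ f m + ∑ (λ i → f (m + i)) (j * m)         ≡⟨ cong₂ _+_ block (∑-cong (j * m) λ i _ → periodic i) ⟩
  1 + ∑ f (j * m)                             ≡⟨ cong suc (∑-multiples m j) ⟩
  suc j                                       ∎
  where
  open ≡-Reasoning
  f = λ i → [ m ∣? suc i ]

  periodic : ∀ i → f (m + i) ≡ f i
  periodic i = [cong] (m ∣? suc (m + i)) (m ∣? suc i)
    (λ h → ∣m+n∣m⇒∣n (subst (m ∣_) (sym (+-suc m i)) h) ∣-refl)
    (λ h → subst (m ∣_) (+-suc m i) (∣m∣n⇒∣m+n ∣-refl h))

  block : ∑ f m ≡ 1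
  block = begin
    ∑ f m                                     ≡⟨ cong (∑ f) (+-comm m-1 1) ⟨
    ∑ f (m-1 + 1)                             ≡⟨ ∑-split f m-1 1 ⟩
    ∑ f m-1 + (f (m-1 + 0) + 0)               ≡⟨ cong₂ _+_ (∑-cong m-1 λ i i<m-1 → [no] (m ∣? suc i) (>⇒∤ (s<s i<m-1)))
                                                   (cong (λ z → f z + 0) (+-identityʳ m-1)) ⟩
    ∑ (λ _ → 0) m-1 + (f m-1 + 0)             ≡⟨ cong₂ _+_ (trans (∑-const 0 m-1) (*-zeroʳ m-1))
                                                   (cong (_+ 0) ([yes] (m ∣? m) ∣-refl)) ⟩
    1                                         ∎

prime>1 : ∀ {p} → Prime p → 1 < p
prime>1 {p} pp = nonTrivial⇒n>1 p {{prime⇒nonTrivial pp}}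

prime∤⇒coprime : ∀ {p k} → Prime p → p ∤ k → Coprime k p
prime∤⇒coprime pp p∤k (i∣k , i∣p) with prime⇒irreducible pp i∣p
... | inj₁ i≡1  = i≡1
... | inj₂ refl = contradiction i∣k p∤k

prime-∣-prime : ∀ {p q} → Prime p → Prime q → p ∣ q → p ≡ q
prime-∣-prime pp pq p∣q with prime⇒irreducible pq p∣q
... | inj₁ refl = contradiction (prime>1 pp) (<-irrefl refl)
... | inj₂ p≡q  = p≡q

-- The indicator identity is summed over 1 to `n`: there are `q` multiples of `p`, `p` multiples of
-- `q`, and a single common multiple, `n` itself.
φ-semiprime : ∀ {p q} → Prime p → Prime q → p ≢ q → φ (p * q) + (p + q) ≡ suc (p * q)
φ-semiprime {p} {q} pp pq p≢q = begin
  φ n + (p + q)                                ≡⟨ cong₂ _+_ (φ≡∑ n) (+-comm p q) ⟩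
  ∑ c n + (q + p)                              ≡⟨ cong (_+_ (∑ c n)) (cong₂ _+_ ∑μp ∑μq) ⟨
  ∑ c n + (∑ (μ p) n + ∑ (μ q) n)              ≡⟨ cong (_+_ (∑ c n)) (∑-+ (μ p) (μ q) n) ⟨
  ∑ c n + ∑ (λ i → μ p i + μ q i) n            ≡⟨ ∑-+ c _ n ⟨
  ∑ (λ i → c i + (μ p i + μ q i)) n            ≡⟨ ∑-cong n (λ i _ →
    inclusion-exclusion (coprime? (suc i) n) (p ∣? suc i) (q ∣? suc i) (n ∣? suc i)
      (not-coprime pp p∣n) (not-coprime pq q∣n) coprime n∣k (∣-trans p∣n) (∣-trans q∣n)) ⟩
  ∑ (λ i → 1 + μ n i) n                        ≡⟨ ∑-+ (λ _ → 1) (μ n) n ⟩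
  ∑ (λ _ → 1) n + ∑ (μ n) n                    ≡⟨ cong₂ _+_ (trans (∑-const 1 n) (*-identityʳ n))
                                                    (trans (cong (∑ (μ n)) (sym (+-identityʳ n))) (∑-multiples n 1)) ⟩
  n + 1                                        ≡⟨ +-comm n 1 ⟩
  suc n                                        ∎
  where
  open ≡-Reasoning
  n = p * q
  instance
    p≢0 : NonZero p
    p≢0 = prime⇒nonZero pp
    q≢0 : NonZero q
    q≢0 = prime⇒nonZero pq
    n≢0 : NonZero n
    n≢0 = m*n≢0 p q
  c : ℕ → ℕ
  c i = [ coprime? (suc i) n ]
  μ : ℕ → ℕ → ℕ
  μ m i = [ m ∣? suc i ]
  ∑μp : ∑ (μ p) n ≡ q
  ∑μp = trans (cong (∑ (μ p)) (*-comm p q)) (∑-multiples p q)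
  ∑μq : ∑ (μ q) n ≡ p
  ∑μq = ∑-multiples q p

  not-coprime : ∀ {r k} → Prime r → r ∣ n → r ∣ k → ¬ Coprime k n
  not-coprime pr r∣n r∣k cop = <-irrefl (sym (cop (r∣k , r∣n))) (prime>1 pr)

  p∣n : p ∣ n
  p∣n = m∣m*n q
  q∣n : q ∣ n
  q∣n = n∣m*n p

  n∣k : ∀ {k} → p ∣ k → q ∣ k → n ∣ k
  n∣k (divides j eq) q∣k with euclidsLemma j p pq (subst (q ∣_) eq q∣k)
  ... | inj₁ (divides l refl) = divides l (trans eq
    (trans (*-assoc l q p) (cong (l *_) (*-comm q p))))
  ... | inj₂ q∣p = contradiction (sym (prime-∣-prime pq pp q∣p)) p≢q

  coprime : ∀ {k} → p ∤ k → q ∤ k → Coprime k n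
  coprime p∤k q∤k (g∣k , g∣n) = prime∤⇒coprime pq q∤k (g∣k , coprime-divisor
    (λ (h∣g , h∣p) → prime∤⇒coprime pp p∤k (∣-trans h∣g g∣k , h∣p)) g∣n)

-- Division on the machine

quot-rem : ∀ x {y} → y ≢ 0 → x ≡ apply rem x y + apply quot x y * y
quot-rem x {zero}  y≢0 = contradiction refl y≢0
quot-rem x {suc y} y≢0 = m≡m%n+[m/n]*n x (suc y)

rem< : ∀ x {y} → y ≢ 0 → apply rem x y < y
rem< x {zero}  y≢0 = contradiction refl y≢0
rem< x {suc y} y≢0 = m%n<n x (suc y)

quot*≤ : ∀ x y → apply quot x y * y ≤ x
quot*≤ x zero    = z≤n
quot*≤ x (suc y) = subst (apply quot x (suc y) * suc y ≤_) (sym (quot-rem x {suc y} λ ())) (m≤n+m _ (apply rem x (suc y)))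

quot-unique : ∀ {x y r} k → r < y → x ≡ r + k * y → apply quot x y ≡ k
quot-unique {y = y@(suc _)} {r} k r<y refl = trans (+-distrib-/-∣ʳ r (n∣m*n k))
  (cong₂ _+_ (m<n⇒m/n≡0 r<y) (m*n/n≡m k y))

rem-multiple : ∀ {x y} k → x ≡ k * y → apply rem x y ≡ 0
rem-multiple {x} {zero} k eq = trans eq (*-zeroʳ k)
rem-multiple {x} {suc y} k eq = +-cancelʳ-≡ _ (apply rem x (suc y)) 0 (trans (sym (quot-rem x {suc y} λ ())) (trans eq (cong (_* suc y) (sym (quot-unique k z<s eq)))))

-- The quotient is rounded so that the remainder lies in [1 , y].
ceiling-step : ∀ {x y} → y ≢ 0 → 1 ≤ x → let q = apply quot (x ∸ 1) y; r = x ∸ q * y in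
  1 ≤ r × r ≤ y × x ≡ r + q * y
ceiling-step {x} {y} y≢0 1≤x =
  subst (1 ≤_) (sym r≡) z<s , subst (_≤ y) (sym r≡) (rem< (x ∸ 1) y≢0) , trans x≡ (cong (_+ q * y) (sym r≡))
  where
  q = apply quot (x ∸ 1) y
  r = apply rem (x ∸ 1) y
  x≡ : x ≡ suc r + q * y
  x≡ = trans (sym (m+[n∸m]≡n 1≤x)) (cong suc (quot-rem (x ∸ 1) y≢0))
  r≡ : x ∸ q * y ≡ suc r
  r≡ = trans (cong (_∸ q * y) x≡) (m+n∸n≡m (suc r) (q * y))

-- Since the quotient is positive, `r + r < r + y ≤ x`. This halving makes the number of Euclidean
-- rounds logarithmic.
rem-halves : ∀ {x y V} → 1 ≤ y → y ≤ x → x < 2 * V → apply rem x y < V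
rem-halves {x} {y} {V} 1≤y y≤x x<2V = *-cancelˡ-< 2 (apply rem x y) V (begin-strict
  2 * r          ≡⟨ cong (_+_ r) (+-identityʳ r) ⟩
  r + r          ≤⟨ +-monoʳ-≤ r (<⇒≤ r<y) ⟩
  r + y          ≤⟨ +-monoʳ-≤ r (≤-trans (≤-reflexive (sym (*-identityˡ y))) (*-monoˡ-≤ y 1≤q)) ⟩
  r + q * y      ≡⟨ x≡ ⟨
  x              <⟨ x<2V ⟩
  2 * V          ∎)
  where
  open ≤-Reasoning
  q = apply quot x y
  r = apply rem x y
  x≡ = quot-rem x (m<n⇒n≢0 1≤y)
  r<y = rem< x (m<n⇒n≢0 1≤y)
  1≤q : 1 ≤ q
  1≤q = n≢0⇒n>0 λ q≡0 → <⇒≱ r<y (≤-trans y≤x (≤-reflexive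
    (trans x≡ (trans (cong (λ z → r + z * y) q≡0) (+-identityʳ r)))))

-- One-sided rational approximation

module Euclid (N d t : ℕ) (3dt<2N : 3 * (d * t) < 2 * N) where

  -- (d , t) = a (d₁ , t₁) + b (d₂ , − t₂)
  record Coordinates (a b d₁ t₁ d₂ t₂ : ℕ) : Set where
    field
      coprime : Coprime a b
      d≡      : d ≡ a * d₁ + b * d₂
      t≡      : t + b * t₂ ≡ a * t₁

  open Coordinates

  Pending : (d₁ t₁ d₂ t₂ : ℕ) → Set
  Pending d₁ t₁ d₂ t₂ = ∃₂ λ a b → 1 ≤ a × 1 ≤ b × Coordinates a b d₁ t₁ d₂ t₂

  -- Change of basis: with `v′ = v + q u`, the vector `a u + b v` equals `(a − q b) u + b v′`. The
  -- old values are written as sums to avoid truncated subtraction; `shift-over` is the same with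
  -- the roles exchanged.
  shift-under : ∀ {a b d₁ t₁ d₂ t₂} q → Coordinates (a + q * b) b d₁ t₁ d₂ (t₂ + q * t₁) →
    Coordinates a b d₁ t₁ (d₂ + q * d₁) t₂
  shift-under {a} {b} {d₁} {t₁} {d₂} {t₂} q c = record
    { coprime = λ (i∣a , i∣b) → coprime c (∣m∣n⇒∣m+n i∣a (∣n⇒∣m*n q i∣b) , i∣b)
    ; d≡ = trans (d≡ c) (solve₁ a b d₁ d₂ q)
    ; t≡ = +-cancelʳ-≡ (q * b * t₁) _ _ (trans (solve₂ t b t₁ t₂ q)
             (trans (t≡ c) (*-distribʳ-+ t₁ a (q * b)))) }
    where
    solve₁ : ∀ a b d₁ d₂ q → (a + q * b) * d₁ + b * d₂ ≡ a * d₁ + b * (d₂ + q * d₁)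
    solve₁ = solve-∀
    solve₂ : ∀ t b t₁ t₂ q → t + b * t₂ + q * b * t₁ ≡ t + b * (t₂ + q * t₁)
    solve₂ = solve-∀

  shift-over : ∀ {a b d₁ t₁ d₂ t₂} q → Coordinates a (b + q * a) d₁ (t₁ + q * t₂) d₂ t₂ →
    Coordinates a b (d₁ + q * d₂) t₁ d₂ t₂
  shift-over {a} {b} {d₁} {t₁} {d₂} {t₂} q c = record
    { coprime = λ (i∣a , i∣b) → coprime c (i∣a , ∣m∣n⇒∣m+n i∣b (∣n⇒∣m*n q i∣a))
    ; d≡ = trans (d≡ c) (solve₁ a b d₁ d₂ q)
    ; t≡ = +-cancelʳ-≡ (q * a * t₂) _ _ (trans (solve₂ t a b t₂ q) (trans (t≡ c) (solve₃ a t₁ t₂ q))) }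
    where
    solve₁ : ∀ a b d₁ d₂ q → a * d₁ + (b + q * a) * d₂ ≡ a * (d₁ + q * d₂) + b * d₂
    solve₁ = solve-∀
    solve₂ : ∀ t a b t₂ q → t + b * t₂ + q * a * t₂ ≡ t + (b + q * a) * t₂
    solve₂ = solve-∀
    solve₃ : ∀ a t₁ t₂ q → a * (t₁ + q * t₂) ≡ a * t₁ + q * a * t₂
    solve₃ = solve-∀

  -- `a t₁` exceeds `q b t₁` by `t + b t₂`, which is positive because the remainder `t₂` is. This is
  -- why the division leaves a remainder in `[1 , t₁]` instead of `[0 , t₁)`.
  pending-under : ∀ {d₁ t₁ d₂ t₂} q → 1 ≤ t₂ → Pending d₁ t₁ d₂ (t₂ + q * t₁) →
    Pending d₁ t₁ (d₂ + q * d₁) t₂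
  pending-under {d₁} {t₁} {d₂} {t₂} q 1≤t₂ (a , b , 1≤a , 1≤b , c) =
    a ∸ q * b , b , m<n⇒0<n∸m qb<a , 1≤b ,
    shift-under q (subst (λ z → Coordinates z b d₁ t₁ d₂ (t₂ + q * t₁)) (sym (m∸n+n≡m (<⇒≤ qb<a))) c)
    where
    open ≤-Reasoning
    qb<a : q * b < a
    qb<a = *-cancelʳ-< t₁ (q * b) a (begin-strict
      q * b * t₁                   ≡⟨ solve₁ q b t₁ ⟩
      b * (q * t₁)                 <⟨ m<n+m _ (*-mono-≤ 1≤b 1≤t₂) ⟩
      b * t₂ + b * (q * t₁)        ≡⟨ *-distribˡ-+ b t₂ (q * t₁) ⟨
      b * (t₂ + q * t₁)            ≤⟨ m≤n+m _ t ⟩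
      t + b * (t₂ + q * t₁)        ≡⟨ t≡ c ⟩
      a * t₁                       ∎)
      where
      solve₁ : ∀ q b t₁ → q * b * t₁ ≡ b * (q * t₁)
      solve₁ = solve-∀

  private
    -- Here the constant of the theorem is decided: equality holds at `a = 1`, `b = 2`, `c = 1`,
    -- `q = 3`, and `a = b = c = 1`, `q = 2` violates the inequality.
    2q≤3bc : ∀ a b c q → 1 ≤ a → 1 ≤ b → 1 ≤ c → q * a ≡ b + c → ¬ (a ≡ 1 × b ≡ 1) →
      2 * q ≤ 3 * (b * c)
    2q≤3bc 1 1 c q _ _ _ _ a≢1∨b≢1 = contradiction (refl , refl) a≢1∨b≢1
    2q≤3bc 1 (suc (suc b)) (suc c) q _ _ _ eq _ = begin
      2 * q                               ≡⟨ cong (2 *_) (trans (sym (*-identityʳ q)) eq) ⟩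
      2 * (2 + b + (1 + c))               ≤⟨ m≤m+n _ _ ⟩
      2 * (2 + b + (1 + c)) + (b + 4 * c + 3 * (b * c)) ≡⟨ solve₁ b c ⟩
      3 * ((2 + b) * (1 + c))             ∎
      where
      open ≤-Reasoning
      solve₁ : ∀ b c → 2 * (2 + b + (1 + c)) + (b + 4 * c + 3 * (b * c)) ≡ 3 * ((2 + b) * (1 + c))
      solve₁ = solve-∀
    2q≤3bc (suc (suc a)) (suc b) (suc c) q _ _ _ eq _ = begin
      2 * q                               ≡⟨ *-comm 2 q ⟩
      q * 2                               ≤⟨ *-monoʳ-≤ q (s≤s (s≤s z≤n)) ⟩
      q * (2 + a)                         ≡⟨ eq ⟩
      (1 + b) + (1 + c)                   ≤⟨ m≤m+n _ _ ⟩
      (1 + b) + (1 + c) + (1 + 2 * b + 2 * c + 3 * (b * c)) ≡⟨ solve₁ b c ⟩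
      3 * ((1 + b) * (1 + c))             ∎
      where
      open ≤-Reasoning
      solve₁ : ∀ b c → (1 + b) + (1 + c) + (1 + 2 * b + 2 * c + 3 * (b * c)) ≡ 3 * ((1 + b) * (1 + c))
      solve₁ = solve-∀

    2≤3* : ∀ {x y} → 1 ≤ x → 1 ≤ y → 2 ≤ 3 * (x * y)
    2≤3* 1≤x 1≤y = ≤-trans (n≤1+n 2) (*-monoʳ-≤ 3 (*-mono-≤ 1≤x 1≤y))

  -- If c = q * a − b were positive, then t = c t₂ + a r, and 2q ≤ 3bc would give 2N ≤ 3dt.
  no-overshoot : ∀ {a b d₁ r d₂ t₂} q → 1 ≤ a → 1 ≤ b → ¬ (a ≡ 1 × b ≡ 1) →
    N ≡ (r + q * t₂) * d₂ + t₂ * d₁ →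
    Coordinates a b d₁ (r + q * t₂) d₂ t₂ → q * a ≤ b
  no-overshoot {a} {b} {d₁} {r} {d₂} {t₂} q 1≤a 1≤b ¬11 N≡ co =
    ≮⇒≥ λ b<qa → <⇒≱ 3dt<2N (large b<qa)
    where
    large : b < q * a → 2 * N ≤ 3 * (d * t)
    large b<qa = begin
      2 * N
        ≡⟨ cong (2 *_) N≡ ⟩
      2 * ((r + q * t₂) * d₂ + t₂ * d₁)
        ≡⟨ solve₁ r q t₂ d₂ d₁ ⟩
      2 * (t₂ * d₁) + 2 * q * (t₂ * d₂) + 2 * (r * d₂)
        -- Coefficients are compared with three of the four products in
        -- `3 (a d₁ + b d₂) (c t₂ + a r)`; the fourth is added in the next step.
        ≤⟨ +-mono-≤ (+-mono-≤ (*-monoˡ-≤ (t₂ * d₁) (2≤3* 1≤a 1≤c))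
                              (*-monoˡ-≤ (t₂ * d₂) (2q≤3bc a b c q 1≤a 1≤b 1≤c qa≡b+c ¬11)))
                    (*-monoˡ-≤ (r * d₂) (2≤3* 1≤a 1≤b)) ⟩
      3 * (a * c) * (t₂ * d₁) + 3 * (b * c) * (t₂ * d₂) + 3 * (a * b) * (r * d₂)
        ≤⟨ m≤m+n _ (3 * (a * d₁ * (a * r))) ⟩
      3 * (a * c) * (t₂ * d₁) + 3 * (b * c) * (t₂ * d₂) + 3 * (a * b) * (r * d₂) + 3 * (a * d₁ * (a * r))
        ≡⟨ solve₂ a b c d₁ d₂ t₂ r ⟩
      3 * ((a * d₁ + b * d₂) * (c * t₂ + a * r))
        ≡⟨ cong₂ (λ x y → 3 * (x * y)) (d≡ co) t≡ct₂+ar ⟨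
      3 * (d * t)
        ∎
      where
      open ≤-Reasoning
      c = q * a ∸ b
      1≤c : 1 ≤ c
      1≤c = m<n⇒0<n∸m b<qa
      qa≡b+c : q * a ≡ b + c
      qa≡b+c = sym (m+[n∸m]≡n (<⇒≤ b<qa))
      t≡ct₂+ar : t ≡ c * t₂ + a * r
      t≡ct₂+ar = +-cancelʳ-≡ (b * t₂) t _ (trans (t≡ co) (trans (solve₃ a r q t₂)
        (trans (cong (λ z → a * r + z * t₂) qa≡b+c) (solve₄ a r b c t₂))))
        where
        solve₃ : ∀ a r q t₂ → a * (r + q * t₂) ≡ a * r + q * a * t₂
        solve₃ = solve-∀
        solve₄ : ∀ a r b c t₂ → a * r + (b + c) * t₂ ≡ c * t₂ + a * r + b * t₂
        solve₄ = solve-∀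
      solve₁ : ∀ r q t₂ d₂ d₁ → 2 * ((r + q * t₂) * d₂ + t₂ * d₁) ≡ 2 * (t₂ * d₁) + 2 * q * (t₂ * d₂) + 2 * (r * d₂)
      solve₁ = solve-∀
      solve₂ : ∀ a b c d₁ d₂ t₂ r →
        3 * (a * c) * (t₂ * d₁) + 3 * (b * c) * (t₂ * d₂) + 3 * (a * b) * (r * d₂) + 3 * (a * d₁ * (a * r))
        ≡ 3 * ((a * d₁ + b * d₂) * (c * t₂ + a * r))
      solve₂ = solve-∀

  -- If `a = b = 1`, which `no-overshoot` excludes, `d` is already the sum `d₁ + d₂` before the
  -- division. Otherwise `b − q a` is nonnegative, and if it is 0, coprimality forces `a = 1`, so
  -- that `d` is the new `d₁`.
  pending-over : ∀ {d₁ r d₂ t₂} q → N ≡ (r + q * t₂) * d₂ + t₂ * d₁ →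
    Pending d₁ (r + q * t₂) d₂ t₂ →
    d₁ + d₂ ≡ d ⊎ d₁ + q * d₂ ≡ d ⊎ Pending (d₁ + q * d₂) r d₂ t₂
  pending-over {d₁} {r} {d₂} {t₂} q N≡ (a , b , 1≤a , 1≤b , co) = cases (a ≟ 1) (b ≟ 1)
    where
    divide : ∀ b → Coordinates a b (d₁ + q * d₂) r d₂ t₂ →
      d₁ + q * d₂ ≡ d ⊎ Pending (d₁ + q * d₂) r d₂ t₂
    divide zero co′ with refl ← coprime co′ (∣-refl , a ∣0) =
      inj₁ (sym (trans (d≡ co′) (trans (+-identityʳ _) (*-identityˡ (d₁ + q * d₂)))))
    divide b@(suc _) co′ = inj₂ (a , b , 1≤a , s≤s z≤n , co′)

    advance : ¬ (a ≡ 1 × b ≡ 1) → d₁ + q * d₂ ≡ d ⊎ Pending (d₁ + q * d₂) r d₂ t₂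
    advance ¬11 = divide (b ∸ q * a) (shift-over q
      (subst (λ z → Coordinates a z d₁ (r + q * t₂) d₂ t₂)
        (sym (m∸n+n≡m (no-overshoot q 1≤a 1≤b ¬11 N≡ co))) co))

    cases : Dec (a ≡ 1) → Dec (b ≡ 1) →
      d₁ + d₂ ≡ d ⊎ d₁ + q * d₂ ≡ d ⊎ Pending (d₁ + q * d₂) r d₂ t₂
    cases (yes refl) (yes refl) =
      inj₁ (sym (trans (d≡ co) (cong₂ _+_ (+-identityʳ d₁) (+-identityʳ d₂))))
    cases (no a≢1) _        = inj₂ (advance (a≢1 ∘ proj₁))
    cases _        (no b≢1) = inj₂ (advance (b≢1 ∘ proj₂))

  -- With `t₁ = 0` the second component would be `− b t₂ < 0`, but `t ≥ 0`. Hence the loop cannot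
  -- end before `d` has been met.
  not-pending : ∀ {d₁ d₂ t₂} → 1 ≤ t₂ → ¬ Pending d₁ 0 d₂ t₂
  not-pending {t₂ = t₂} 1≤t₂ (a , b , _ , 1≤b , co) =
    <⇒≱ (*-mono-≤ 1≤b 1≤t₂) (≤-trans (m≤n+m (b * t₂) t) (≤-reflexive (trans (t≡ co) (*-zeroʳ a))))

-- Recovering a prime factor from the private exponent

-- `e d` falls short of `k N` by `t < N`, so `k` is `e d / N` rounded up; adding `N ∸ 1` to the
-- numerator performs the rounding.
recover-k : ∀ {e d k N t} → t < N → k * N ≡ e * d + t → apply quot (e * d + (N ∸ 1)) N ≡ k
recover-k {e} {d} {k} {N@(suc N-1)} {t} t<N kN≡ = quot-unique k (s≤s (m∸n≤m N-1 t)) (begin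
  e * d + N-1                     ≡⟨ cong (_+_ (e * d)) (m+[n∸m]≡n (≤-pred t<N)) ⟨
  e * d + (t + (N-1 ∸ t))         ≡⟨ +-assoc (e * d) t (N-1 ∸ t) ⟨
  e * d + t + (N-1 ∸ t)           ≡⟨ cong (_+ (N-1 ∸ t)) kN≡ ⟨
  k * N + (N-1 ∸ t)               ≡⟨ +-comm (k * N) (N-1 ∸ t) ⟩
  N-1 ∸ t + k * N                 ∎)
  where open ≡-Reasoning

recover-sum : ∀ {n e d k N t Φ s} → t < N → k * N ≡ e * d + t → 1 ≤ k →
  e * d ≡ suc (k * Φ) → Φ + s ≡ suc n →
  n + 1 ∸ apply quot (e * d ∸ 1) (apply quot (e * d + (N ∸ 1)) N) ≡ s
recover-sum {n} {e} {d} {k} {N} {t} {Φ} {s} t<N kN≡ 1≤k ed≡ Φ+s≡ = begin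
  n + 1 ∸ apply quot (e * d ∸ 1) (apply quot (e * d + (N ∸ 1)) N) ≡⟨ cong (λ z → n + 1 ∸ apply quot (e * d ∸ 1) z) (recover-k {e} {d} {k} t<N kN≡) ⟩
  n + 1 ∸ apply quot (e * d ∸ 1) k   ≡⟨ cong (n + 1 ∸_) (quot-unique Φ 1≤k (trans (cong (_∸ 1) ed≡) (*-comm k Φ))) ⟩
  n + 1 ∸ Φ                          ≡⟨ cong (_∸ Φ) (trans (+-comm n 1) (sym Φ+s≡)) ⟩
  Φ + s ∸ Φ                          ≡⟨ m+n∸m≡n Φ s ⟩
  s                                  ∎
  where open ≡-Reasoning

-- Bisection for the smaller factor when the sum is known

module _ {w} (w≢0 : w ≢ 0) where

  private
    -- Half the width rounded up: the probe then lies strictly beyond the left end, and both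
    -- possible new widths, `h ∸ 1` and `w ∸ h`, are at most `w / 2`.
    h = apply quot (w + 1) 2

    w+1≡ : w + 1 ≡ apply rem (w + 1) 2 + h * 2
    w+1≡ = quot-rem (w + 1) {2} λ ()

  half≤ : h ≤ w
  half≤ = *-cancelʳ-≤ h w 2 (begin
    h * 2            ≤⟨ quot*≤ (w + 1) 2 ⟩
    w + 1            ≤⟨ +-monoʳ-≤ w (n≢0⇒n>0 w≢0) ⟩
    w + w            ≡⟨ double w ⟩
    w * 2            ∎)
    where
    open ≤-Reasoning
    double : ∀ w → w + w ≡ w * 2
    double = solve-∀

  w≤2*half : w ≤ h * 2
  w≤2*half = ≤-pred (begin
    suc w                             ≡⟨ +-comm 1 w ⟩
    w + 1                             ≡⟨ w+1≡ ⟩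
    apply rem (w + 1) 2 + h * 2       ≤⟨ +-monoˡ-≤ (h * 2) (≤-pred (rem< (w + 1) {2} λ ())) ⟩
    suc (h * 2)                       ∎)
    where open ≤-Reasoning

  half>0 : 1 ≤ h
  half>0 = n≢0⇒n>0 λ h≡0 → w≢0 (n≤0⇒n≡0 (subst (λ z → w ≤ z * 2) h≡0 w≤2*half))

  upper-half< : ∀ {V} → w < 2 * V → w ∸ h < V
  upper-half< {V} w<2V = *-cancelʳ-< 2 (w ∸ h) V (begin-strict
    (w ∸ h) * 2          ≡⟨ *-distribʳ-∸ 2 w h ⟩
    w * 2 ∸ h * 2        ≤⟨ ∸-monoʳ-≤ (w * 2) w≤2*half ⟩
    w * 2 ∸ w            ≡⟨ cong (_∸ w) (double w) ⟩
    w + w ∸ w            ≡⟨ m+n∸n≡m w w ⟩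
    w                    <⟨ w<2V ⟩
    2 * V                ≡⟨ *-comm 2 V ⟩
    V * 2                ∎)
    where
    open ≤-Reasoning
    double : ∀ w → w * 2 ≡ w + w
    double = solve-∀

  lower-half< : ∀ {V} → w < 2 * V → h ∸ 1 < V
  lower-half< {V} w<2V = *-cancelʳ-< 2 (h ∸ 1) V (begin-strict
    (h ∸ 1) * 2          ≡⟨ *-distribʳ-∸ 2 h 1 ⟩
    h * 2 ∸ 2            ≤⟨ ∸-monoˡ-≤ 2 (quot*≤ (w + 1) 2) ⟩
    w + 1 ∸ 2            ≤⟨ ≤-reflexive (cong (_∸ 2) (+-comm w 1)) ⟩
    w ∸ 1                ≤⟨ m∸n≤m w 1 ⟩
    w                    <⟨ w<2V ⟩
    2 * V                ≡⟨ *-comm 2 V ⟩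
    V * 2                ∎)
    where open ≤-Reasoning

module _ {p q m : ℕ} (q≤p : q ≤ p) (m<p : m < p) where

  private
    open ≤-Reasoning

    -- Both directions rest on `m (p + q − m) − p q = (m − q) (p − m)`, whose sign for `m < p` is
    -- that of `m − q`.
    above-q : q < m → p * q < m * (p + q ∸ m)
    above-q q<m = begin-strict
      p * q                              ≡⟨ cong (_* q) p≡ ⟨
      (q + i + j) * q                    <⟨ m<m+n _ (*-mono-≤ (m<n⇒0<n∸m q<m) (m<n⇒0<n∸m m<p)) ⟩
      (q + i + j) * q + i * j            ≡⟨ solve₁ q i j ⟩
      (q + i) * (q + j)                  ≡⟨ cong₂ _*_ m≡ (trans (sym (m+n∸m≡n (q + i) (q + j))) (cong₂ _∸_ (trans (solve₂ q i j) (cong (_+ q) p≡)) m≡)) ⟩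
      m * (p + q ∸ m)                    ∎
      where
      i = m ∸ q
      j = p ∸ m
      m≡ : q + i ≡ m
      m≡ = m+[n∸m]≡n (<⇒≤ q<m)
      p≡ : q + i + j ≡ p
      p≡ = trans (cong (_+ j) m≡) (m+[n∸m]≡n (<⇒≤ m<p))
      solve₁ : ∀ q i j → (q + i + j) * q + i * j ≡ (q + i) * (q + j)
      solve₁ = solve-∀
      solve₂ : ∀ q i j → (q + i) + (q + j) ≡ q + i + j + q
      solve₂ = solve-∀

    below-q : m ≤ q → m * (p + q ∸ m) ≤ p * q
    below-q m≤q = begin
      m * (p + q ∸ m)                    ≡⟨ cong (m *_) (trans (cong (_∸ m) (trans (sym (cong₂ _+_ p≡ q≡)) (solve₂ m i j))) (m+n∸m≡n m (m + i + j))) ⟩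
      m * (m + i + j)                    ≤⟨ m≤m+n _ (j * i) ⟩
      m * (m + i + j) + j * i            ≡⟨ solve₁ m i j ⟩
      (m + j) * (m + i)                  ≡⟨ cong₂ _*_ p≡ q≡ ⟩
      p * q                              ∎
      where
      i = q ∸ m
      j = p ∸ m
      q≡ : m + i ≡ q
      q≡ = m+[n∸m]≡n m≤q
      p≡ : m + j ≡ p
      p≡ = m+[n∸m]≡n (<⇒≤ m<p)
      solve₁ : ∀ m i j → m * (m + i + j) + j * i ≡ (m + j) * (m + i)
      solve₁ = solve-∀
      solve₂ : ∀ m i j → (m + j) + (m + i) ≡ m + (m + i + j)
      solve₂ = solve-∀

  search-above : m * (p + q ∸ m) ∸ p * q ≢ 0 → q < m
  search-above h = ≰⇒> λ m≤q → h (m≤n⇒m∸n≡0 (below-q m≤q))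

  search-below : m * (p + q ∸ m) ∸ p * q ≡ 0 → m ≤ q
  search-below h = ≮⇒≥ λ q<m → <⇒≱ (above-q q<m) (m∸n≡0⇒m≤n h)

-- The divisors of `p q` are 1, `q`, `p` and `p q`; lying above 1 and below its cofactor leaves only
-- `q`. The acceptance test checks just this.
smaller-factor : ∀ {p q c} → Prime p → Prime q → q < p → ∀ l → 1 < l → l < c → p * q ≡ l * c → l ≡ q
smaller-factor {p} {q} {c} pp pq q<p l 1<l l<c eq = cases (euclidsLemma l c pq (subst (q ∣_) eq (n∣m*n p)))
  where
  instance
    p≢0 : NonZero p
    p≢0 = prime⇒nonZero pp
    q≢0 : NonZero q
    q≢0 = prime⇒nonZero pq

  cofactor : ∀ {x y} → p ≡ x * y → x ≡ 1 ⊎ x ≡ p × y ≡ 1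
  cofactor {x} {y} p≡ with prime⇒irreducible pp (divides y (trans p≡ (*-comm x y)))
  ... | inj₁ x≡1  = inj₁ x≡1
  ... | inj₂ refl = inj₂ (refl , *-cancelˡ-≡ y 1 p (trans (sym p≡) (sym (*-identityʳ p))))

  cases : q ∣ l ⊎ q ∣ c → l ≡ q
  cases (inj₁ (divides j refl)) with cofactor {j} {c} (*-cancelʳ-≡ p (j * c) q (trans eq (rearrange j q c)))
    where
    rearrange : ∀ j q c → j * q * c ≡ j * c * q
    rearrange = solve-∀
  ... | inj₁ refl       = +-identityʳ q
  ... | inj₂ (_ , refl) = contradiction (<-trans 1<l l<c) (<-irrefl refl)
  cases (inj₂ (divides j refl)) with cofactor {l} {j} (*-cancelʳ-≡ p (l * j) q (trans eq (sym (*-assoc l j q))))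
  ... | inj₁ refl          = contradiction 1<l (<-irrefl refl)
  ... | inj₂ (refl , refl) = contradiction l<c (<⇒≯ (subst (_< p) (sym (+-identityʳ q)) q<p))

-- The real bound on the private exponent

module _ where
  open Order
  open ℝ
  open ℚ.+-*-Solver

  ι-* : ∀ m n → ι (m * n) ≡ ι m ℚ.* ι n
  ι-* m n = ℚ.toℚᵘ-injective (ℚᵘ.≃-trans (ℚᵘ.*≡* (cong (ℤ._* + 1) (ℤ.pos-* m n)))
    (ℚᵘ.≃-sym (ℚ.toℚᵘ-homo-* (ι m) (ι n))))

  ι-+ : ∀ m n → ι (m + n) ≡ ι m ℚ.+ ι n
  ι-+ m n = ℚ.toℚᵘ-injective (ℚᵘ.≃-trans
    (ℚᵘ.*≡* (cong (ℤ._* + 1) (cong₂ ℤ._+_ (sym (ℤ.*-identityʳ (+ m))) (sym (ℤ.*-identityʳ (+ n))))))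
    (ℚᵘ.≃-sym (ℚ.toℚᵘ-homo-+ (ι m) (ι n))))

  ι-mono-< : ∀ {m n} → m < n → ι m ℚ.< ι n
  ι-mono-< {m} {n} h = ℚ.*<* (subst₂ ℤ._<_ (sym (ℤ.*-identityʳ (+ m))) (sym (ℤ.*-identityʳ (+ n))) (ℤ.+<+ h))

  ι-cancel-< : ∀ {m n} → ι m ℚ.< ι n → m < n
  ι-cancel-< {m} {n} (ℚ.*<* h) =
    ℤ.drop‿+<+ (subst₂ ℤ._<_ (ℤ.*-identityʳ (+ m)) (ℤ.*-identityʳ (+ n)) h)

  /1≡ι : ∀ n → + n / 1 ≡ ι n
  /1≡ι n = ℚ.↥p/↧p≡p (ι n)

  ι*1/≡1 : ∀ m .{{_ : NonZero m}} → ι m ℚ.* (+ 1 / m) ≡ 1ℚ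
  ι*1/≡1 m@(suc _) = ℚ.toℚᵘ-injective (ℚᵘ.≃-trans (ℚ.toℚᵘ-homo-* (ι m) (+ 1 / m))
    (ℚᵘ.≃-trans (ℚᵘ.*-congˡ {ℚ.toℚᵘ (ι m)} (ℚ.toℚᵘ-fromℚᵘ (ℚᵘ.mkℚᵘ (+ 1) _)))
      (ℚᵘ.*≡* (trans (ℤ.*-identityʳ (+ m ℤ.* + 1)) (trans (ℤ.*-identityʳ (+ m))
        (sym (trans (ℤ.*-identityˡ (+ 1 ℤ.* + m)) (ℤ.*-identityˡ (+ m)))))))))

  ℚ-*-monoʳ-< : ∀ {a x y} → 0ℚ ℚ.< a → x ℚ.< y → a ℚ.* x ℚ.< a ℚ.* y
  ℚ-*-monoʳ-< {a} ha = ℚ.*-monoʳ-<-pos a {{ℚ.positive ha}}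

  ℚ-*-cancelˡ-< : ∀ {a x y} → 0ℚ ℚ.≤ a → a ℚ.* x ℚ.< a ℚ.* y → x ℚ.< y
  ℚ-*-cancelˡ-< {a} ha = ℚ.*-cancelˡ-<-nonNeg a {{ℚ.nonNegative ha}}

  pos-cancelˡ : ∀ {a b} → 0ℚ ℚ.≤ a → 0ℚ ℚ.< a ℚ.* b → 0ℚ ℚ.< b
  pos-cancelˡ {a} {b} ha h = ℚ-*-cancelˡ-< ha (subst (ℚ._< a ℚ.* b) (sym (ℚ.*-zeroʳ a)) h)

  pos-cancelʳ : ∀ {a b} → 0ℚ ℚ.≤ b → 0ℚ ℚ.< a ℚ.* b → 0ℚ ℚ.< a
  pos-cancelʳ {a} {b} hb h = pos-cancelˡ hb (subst (0ℚ ℚ.<_) (ℚ.*-comm a b) h)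

  sq-cancel-< : ∀ {x y} → 0ℚ ℚ.≤ y → x ℚ.* x ℚ.< y ℚ.* y → x ℚ.< y
  sq-cancel-< {x} {y} hy h with compare x y
  ... | inj₁ x<y = x<y
  ... | inj₂ y≤x = contradiction (ℚ.<-≤-trans h (sq-mono≤ hy y≤x)) (ℚ.<-irrefl refl)

  √-lower : ∀ {r q} → 0ℚ ℚ.< q → Lower (√ r) q → q ℚ.* q ℚ.< r
  √-lower h (inj₁ q<0) = contradiction (ℚ.<-trans h q<0) (ℚ.<-irrefl refl)
  √-lower h (inj₂ q²<r) = q²<r

  -- a₁ < √(2/3) n and b₁ > √(3n) > √(2/3) s
  gap-bound : ∀ {n s a a₁ b₁} → 0ℚ ℚ.< n → 0ℚ ℚ.≤ s → 0ℚ ℚ.< a → 0ℚ ℚ.< b₁ → a ℚ.≤ a₁ ℚ.- b₁ →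
    ι 3 ℚ.* (a₁ ℚ.* a₁) ℚ.< ι 2 ℚ.* (n ℚ.* n) → ι 3 ℚ.* n ℚ.< b₁ ℚ.* b₁ →
    ι 2 ℚ.* (s ℚ.* s) ℚ.< ι 9 ℚ.* n →
    0ℚ ℚ.< n ℚ.- s × ι 3 ℚ.* (a ℚ.* a) ℚ.< ι 2 ℚ.* ((n ℚ.- s) ℚ.* (n ℚ.- s))
  gap-bound {n} {s} {a} {a₁} {b₁} n>0 s≥0 a>0 b₁>0 a≤ ha₁ hb₁ hs = w>0 , goal
    where
    w = n ℚ.- s
    2≥0 = ι≥0 2
    3≥0 = ι≥0 3
    a₁>0 : 0ℚ ℚ.< a₁
    a₁>0 = ℚ.<-≤-trans (pos++ a>0 b₁>0) (subst (a ℚ.+ b₁ ℚ.≤_) (solve 2 (λ x y → x :- y :+ y := x) refl a₁ b₁) (ℚ.+-monoˡ-≤ b₁ a≤))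
    -- The squares are compared through `3 a₁² s² ≤ 2 n² s² < 9 n³ < 3 b₁² n²`.
    a₁s<b₁n : a₁ ℚ.* s ℚ.< b₁ ℚ.* n
    a₁s<b₁n = sq-cancel-< (ℚ.<⇒≤ (pos* b₁>0 n>0)) (ℚ-*-cancelˡ-< 3≥0 (ℚ.≤-<-trans
      (subst₂ ℚ._≤_ (solve 3 (λ k x y → (k :* (x :* x)) :* (y :* y) := k :* ((x :* y) :* (x :* y))) refl (ι 3) a₁ s)
        (solve 3 (λ k x y → (k :* (x :* x)) :* (y :* y) := (x :* x) :* (k :* (y :* y))) refl (ι 2) n s)
        (ℚ.*-monoʳ-≤-nonNeg (s ℚ.* s) {{ℚ.nonNegative (nn* s≥0 s≥0)}} (ℚ.<⇒≤ ha₁)))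
      (ℚ.<-trans (ℚ-*-monoʳ-< (pos* n>0 n>0) hs)
        (subst₂ ℚ._<_ (solve 1 (λ x → (con (ι 3) :* (x :* x)) :* (con (ι 3) :* x) := (x :* x) :* (con (ι 9) :* x)) refl n)
          (solve 2 (λ x y → (con (ι 3) :* (x :* x)) :* (y :* y) := con (ι 3) :* ((y :* x) :* (y :* x))) refl n b₁)
          (ℚ-*-monoʳ-< {ι 3 ℚ.* (n ℚ.* n)} (pos* (ι-mono-< {0} {3} (s≤s z≤n)) (pos* n>0 n>0)) hb₁)))))
    -- `a n ≤ (a₁ − b₁) n < a₁ n − a₁ s`. Squaring this and using `3 a₁² < 2 n²` leaves a common
    -- factor `n²` to cancel.
    an<a₁w : a ℚ.* n ℚ.< a₁ ℚ.* w
    an<a₁w = ℚ.≤-<-trans (ℚ.*-monoʳ-≤-nonNeg n {{ℚ.nonNegative (ℚ.<⇒≤ n>0)}} a≤)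
      (undiff (subst (0ℚ ℚ.<_)
        (solve 4 (λ x y n s → y :* n :- x :* s := x :* (n :- s) :- (x :- y) :* n) refl a₁ b₁ n s)
        (diff a₁s<b₁n)))
    an>0 : 0ℚ ℚ.< a ℚ.* n
    an>0 = pos* a>0 n>0
    w>0 : 0ℚ ℚ.< w
    w>0 = pos-cancelˡ (ℚ.<⇒≤ a₁>0) (ℚ.<-trans an>0 an<a₁w)
    goal : ι 3 ℚ.* (a ℚ.* a) ℚ.< ι 2 ℚ.* (w ℚ.* w)
    goal = ℚ-*-cancelˡ-< (ℚ.<⇒≤ (pos* n>0 n>0)) (ℚ.<-trans
      (subst (ℚ._< ι 3 ℚ.* ((a₁ ℚ.* w) ℚ.* (a₁ ℚ.* w))) (solve 3 (λ k x n → k :* ((x :* n) :* (x :* n)) := (n :* n) :* (k :* (x :* x))) refl (ι 3) a n)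
        (ℚ-*-monoʳ-< {ι 3} (ι-mono-< {0} {3} (s≤s z≤n)) (sq-mono (ℚ.<⇒≤ an>0) an<a₁w)))
      (subst₂ ℚ._<_ (solve 3 (λ k x w → (w :* w) :* (k :* (x :* x)) := k :* ((x :* w) :* (x :* w))) refl (ι 3) a₁ w)
        (solve 3 (λ k n w → (w :* w) :* (k :* (n :* n)) := (n :* n) :* (k :* (w :* w))) refl (ι 2) n w)
        (ℚ-*-monoʳ-< (pos* w>0 w>0) ha₁)))

  -- A strict inequality of cuts hands over rational witnesses: `z` between `d` and the product,
  -- `a ≤ a₁ − b₁` below the gap, `c` below the inverse root and `l` below `√(2/3)`. The irrational
  -- estimate thereby becomes rational arithmetic with squares.
  hypothesis-bound : ∀ {d n s m} .{{_ : NonZero m}} → 2 * (s * s) < 9 * n → 0 < n →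
    natᵣ d <ᵣ (√ (+ 2 / 3) *ᵣ natᵣ n -ᵣ √ (+ (3 * n) / 1)) *ᵣ (m ^-½) →
    s < n × 3 * (m * (d * d)) < 2 * ((n ∸ s) * (n ∸ s))
  hypothesis-bound {d} {n} {s} {m} 2s²<9n 0<n
    (z , d<z , a , _ , c , f ,
      (a₁ , b₁ , (l , _ , l′ , u′ , hl , _ , hl′ , hu′ , a₁<ll′ , a₁<lu′ , _) , (b₁>0 , hb₁) , a≤) ,
      _ , hc , (f>0 , _) , z<ac , z<af , _) = s<n , ι-cancel-< final
    where
    D<z : ι d ℚ.< z
    D<z = subst (ℚ._< z) (/1≡ι d) d<z
    z>0 : 0ℚ ℚ.< z
    z>0 = ℚ.≤-<-trans (ι≥0 d) D<z
    -- Signs have to be settled first, since the lower cut of a root also contains every negative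
    -- number. A positive `z` below `a f` with `f > 0` makes `a` positive, and then `z < a c` makes
    -- `c` positive.
    a>0 : 0ℚ ℚ.< a
    a>0 = pos-cancelʳ (ℚ.<⇒≤ f>0) (ℚ.<-trans z>0 z<af)
    c>0 : 0ℚ ℚ.< c
    c>0 = pos-cancelˡ (ℚ.<⇒≤ a>0) (ℚ.<-trans z>0 z<ac)
    n>0 : 0ℚ ℚ.< ι n
    n>0 = ι-mono-< 0<n
    i = + 1 / m
    ca : c ℚ.* c ℚ.< i
    ca = √-lower c>0 hc
    a₁>0 : 0ℚ ℚ.< a₁
    a₁>0 = ℚ.<-≤-trans (pos++ a>0 b₁>0) (subst (a ℚ.+ b₁ ℚ.≤_) (solve 2 (λ x y → x :- y :+ y := x) refl a₁ b₁) (ℚ.+-monoˡ-≤ b₁ a≤))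
    u′>0 : 0ℚ ℚ.< u′
    u′>0 = ℚ.<-trans n>0 (subst (ℚ._< u′) (/1≡ι n) hu′)
    l>0 : 0ℚ ℚ.< l
    l>0 = pos-cancelʳ (ℚ.<⇒≤ u′>0) (ℚ.<-trans a₁>0 a₁<lu′)
    a₁<ln : a₁ ℚ.< l ℚ.* ι n
    a₁<ln = ℚ.<-trans a₁<ll′ (ℚ-*-monoʳ-< l>0 (subst (l′ ℚ.<_) (/1≡ι n) hl′))
    3>0 : 0ℚ ℚ.< ι 3
    3>0 = ι-mono-< {0} {3} (s≤s z≤n)
    3a₁²<2n² : ι 3 ℚ.* (a₁ ℚ.* a₁) ℚ.< ι 2 ℚ.* (ι n ℚ.* ι n)
    3a₁²<2n² = ℚ.<-trans (ℚ-*-monoʳ-< 3>0 (sq-mono (ℚ.<⇒≤ a₁>0) a₁<ln))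
      (subst₂ ℚ._<_ (solve 2 (λ l n → (con (ι 3) :* (n :* n)) :* (l :* l) := con (ι 3) :* ((l :* n) :* (l :* n))) refl l (ι n))
        (solve 1 (λ n → (con (ι 3) :* (n :* n)) :* con (+ 2 / 3) := con (ι 2) :* (n :* n)) refl (ι n))
        (ℚ-*-monoʳ-< {ι 3 ℚ.* (ι n ℚ.* ι n)} (pos* 3>0 (pos* n>0 n>0)) (√-lower l>0 hl)))
    gap = gap-bound {ι n} {ι s} {a} {a₁} {b₁} n>0 (ι≥0 s) a>0 b₁>0 a≤ 3a₁²<2n²
      (subst (ℚ._< b₁ ℚ.* b₁) (trans (/1≡ι (3 * n)) (ι-* 3 n)) hb₁)
      (subst₂ ℚ._<_ (trans (ι-* 2 (s * s)) (cong (ι 2 ℚ.*_) (ι-* s s))) (ι-* 9 n) (ι-mono-< 2s²<9n))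
    s<n : s < n
    s<n = ι-cancel-< (undiff (let h , _ = gap in h))
    ι-w : ι (n ∸ s) ≡ ι n ℚ.- ι s
    ι-w = trans (solve 2 (λ w s → w := (w :+ s) :- s) refl (ι (n ∸ s)) (ι s))
      (cong (ℚ._- ι s) (trans (sym (ι-+ (n ∸ s) s)) (cong ι (m∸n+n≡m (<⇒≤ s<n)))))
    m>0 : 0ℚ ℚ.< ι m
    m>0 = ι-mono-< (n≢0⇒n>0 (≢-nonZero⁻¹ m))
    md²<a² : ι m ℚ.* (ι d ℚ.* ι d) ℚ.< a ℚ.* a
    md²<a² = ℚ.<-trans (ℚ-*-monoʳ-< m>0 (sq-mono (ι≥0 d) (ℚ.<-trans D<z z<ac)))
      (subst₂ ℚ._<_ (solve 3 (λ m a c → (m :* (a :* a)) :* (c :* c) := m :* ((a :* c) :* (a :* c))) refl (ι m) a c)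
        (trans (solve 3 (λ m a i → (m :* (a :* a)) :* i := (a :* a) :* (m :* i)) refl (ι m) a i)
          (trans (cong ((a ℚ.* a) ℚ.*_) (ι*1/≡1 m)) (ℚ.*-identityʳ (a ℚ.* a))))
        (ℚ-*-monoʳ-< {ι m ℚ.* (a ℚ.* a)} (pos* m>0 (pos* a>0 a>0)) ca))
    final : ι (3 * (m * (d * d))) ℚ.< ι (2 * ((n ∸ s) * (n ∸ s)))
    final = subst₂ ℚ._<_
      (sym (trans (ι-* 3 (m * (d * d))) (cong (ι 3 ℚ.*_) (trans (ι-* m (d * d)) (cong (ι m ℚ.*_) (ι-* d d))))))
      (sym (trans (ι-* 2 ((n ∸ s) * (n ∸ s))) (cong (ι 2 ℚ.*_) (trans (ι-* (n ∸ s) (n ∸ s)) (cong₂ ℚ._*_ ι-w ι-w)))))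
      (ℚ.<-trans (ℚ-*-monoʳ-< 3>0 md²<a²) (let _ , h = gap in h))

-- The algorithm

-- rc holds a candidate for d and rs the resulting p + q; the bisection keeps q
-- between rl and rl + rw. A factor that passes the test goes to rq.
rn re rsign rabs rN rd₁ rt₁ rd₂ rt₂ rq ru rv rc rs rw rl rh rm : Reg
rn    = 0
re    = 1
rsign = 2
rabs  = 3
rN    = 4
rd₁   = 5
rt₁   = 6
rd₂   = 7
rt₂   = 8
rq    = 9
ru    = 10
rv    = 11
rc    = 12
rs    = 13
rw    = 14
rl    = 15
rh    = 16
rm    = 17

subtractInput start guessSum probe keepLower keepUpper searchStep : Program
judge commit accept try reduceUnder reduceOver output algorithm : Program

subtractInput = ifNonZero rsign (rN ≔ rn ⟨ add ⟩ rabs) (rN ≔ rn ⟨ monus ⟩ rabs)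

start =
  -- There is no copy instruction; `monus` with a register holding 0 serves as one, here and below.
  (ru ≔ 0) ⨾
  (rd₁ ≔ 0) ⨾
  rt₁ ≔ rN ⟨ monus ⟩ ru ⨾
  (rd₂ ≔ 1) ⨾
  rt₂ ≔ re ⟨ monus ⟩ ru

guessSum =
  (ru ≔ 1) ⨾
  rv ≔ re ⟨ mul ⟩ rc ⨾
  rw ≔ rN ⟨ monus ⟩ ru ⨾
  rw ≔ rv ⟨ add ⟩ rw ⨾
  rw ≔ rw ⟨ quot ⟩ rN ⨾
  rv ≔ rv ⟨ monus ⟩ ru ⨾
  rv ≔ rv ⟨ quot ⟩ rw ⨾
  rs ≔ rn ⟨ add ⟩ ru ⨾
  rs ≔ rs ⟨ monus ⟩ rv ⨾
  (ru ≔ 2) ⨾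
  rw ≔ rs ⟨ quot ⟩ ru ⨾
  rl ≔ 0

probe =
  (ru ≔ 1) ⨾
  rh ≔ rw ⟨ add ⟩ ru ⨾
  (ru ≔ 2) ⨾
  rh ≔ rh ⟨ quot ⟩ ru ⨾
  rm ≔ rl ⟨ add ⟩ rh ⨾
  rv ≔ rs ⟨ monus ⟩ rm ⨾
  rv ≔ rm ⟨ mul ⟩ rv ⨾
  rv ≔ rv ⟨ monus ⟩ rn

keepLower = (ru ≔ 1) ⨾ rw ≔ rh ⟨ monus ⟩ ru

keepUpper = rl ≔ rl ⟨ add ⟩ rh ⨾ rw ≔ rw ⟨ monus ⟩ rh

searchStep = probe ⨾ ifNonZero rv keepLower keepUpper

judge =
  (ru ≔ 1) ⨾
  ru ≔ rl ⟨ monus ⟩ ru ⨾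
  rv ≔ rn ⟨ quot ⟩ rl ⨾
  rv ≔ rv ⟨ monus ⟩ rl ⨾
  -- A product of truncated differences acts as a conjunction: it is nonzero exactly when
  -- `1 < l < n / l`.
  ru ≔ ru ⟨ mul ⟩ rv ⨾
  rv ≔ rn ⟨ rem ⟩ rl

commit = (ru ≔ 0) ⨾ rq ≔ rl ⟨ monus ⟩ ru

accept = judge ⨾ ifNonZero ru (ifNonZero rv skip commit) skip

try = guessSum ⨾ whileNonZero rw searchStep ⨾ accept

reduceUnder =
  (ru ≔ 1) ⨾
  ru ≔ rt₂ ⟨ monus ⟩ ru ⨾
  ru ≔ ru ⟨ quot ⟩ rt₁ ⨾
  rv ≔ ru ⟨ mul ⟩ rd₁ ⨾
  rd₂ ≔ rd₂ ⟨ add ⟩ rv ⨾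
  rv ≔ ru ⟨ mul ⟩ rt₁ ⨾
  rt₂ ≔ rt₂ ⟨ monus ⟩ rv ⨾
  rc ≔ rd₁ ⟨ add ⟩ rd₂

reduceOver =
  ru ≔ rt₁ ⟨ quot ⟩ rt₂ ⨾
  rv ≔ ru ⟨ mul ⟩ rd₂ ⨾
  rd₁ ≔ rd₁ ⟨ add ⟩ rv ⨾
  rt₁ ≔ rt₁ ⟨ rem ⟩ rt₂ ⨾
  (ru ≔ 0) ⨾
  rc ≔ rd₁ ⟨ monus ⟩ ru

output =
  rn ≔ rn ⟨ quot ⟩ rq ⨾
  (ru ≔ 0) ⨾
  re ≔ rq ⟨ monus ⟩ ru

algorithm =
  subtractInput ⨾
  start ⨾
  whileNonZero rt₁ (reduceUnder ⨾ try ⨾ reduceOver ⨾ try) ⨾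
  output

-- `n` and `e` fit into one block of `L` bits, `N` and the absolute value of `x` into two, because
-- `R` is only known to be below `φ(n)²`. The guessed sum gets three, the size assigned by the
-- analysis to `n + 1`.
inputSizes startSizes candidateSizes searchSizes acceptSizes basisSizes outputSizes : Sizes
inputSizes     = ∅ ⟪ rn ↦ 1 ⟫ ⟪ re ↦ 1 ⟫ ⟪ rsign ↦ 1 ⟫ ⟪ rabs ↦ 2 ⟫
startSizes     = ∅ ⟪ re ↦ 1 ⟫ ⟪ rN ↦ 2 ⟫
candidateSizes = ∅ ⟪ rn ↦ 1 ⟫ ⟪ re ↦ 1 ⟫ ⟪ rN ↦ 2 ⟫ ⟪ rc ↦ 2 ⟫
searchSizes    = ∅ ⟪ rn ↦ 1 ⟫ ⟪ rs ↦ 3 ⟫ ⟪ rw ↦ 3 ⟫ ⟪ rl ↦ 3 ⟫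
acceptSizes    = ∅ ⟪ rn ↦ 1 ⟫ ⟪ rl ↦ 3 ⟫
basisSizes     = ∅ ⟪ rd₁ ↦ 2 ⟫ ⟪ rt₁ ↦ 2 ⟫ ⟪ rd₂ ↦ 2 ⟫ ⟪ rt₂ ↦ 2 ⟫
outputSizes    = ∅ ⟪ rn ↦ 1 ⟫ ⟪ rq ↦ 1 ⟫

-- The two loop weights are `k * (suc k + κ) + suc k` from `runs-while`, with `k = 3` for the
-- bisection and `k = 2` for the Euclidean loop.
searchWeight tryWeight roundWeight loopWeight totalWeight : ℕ
searchWeight = 3 * (4 + weight searchStep searchSizes) + 4
tryWeight    = weight guessSum candidateSizes + (searchWeight + weight accept acceptSizes)
roundWeight  = weight reduceUnder basisSizes + (tryWeight + (weight reduceOver basisSizes + tryWeight))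
loopWeight   = 2 * (3 + roundWeight) + 3
totalWeight  = weight subtractInput inputSizes + (weight start startSizes + (loopWeight + weight output outputSizes))

-- Correctness and running time of the program, given the integer form of the hypotheses

module Verification
  (L p q n e d k N t Φ : ℕ) (1≤L : 1 ≤ L)
  (pp : Prime p) (pq : Prime q) (q<p : q < p) (n≡pq : n ≡ p * q)
  (ed≡1+kΦ : e * d ≡ suc (k * Φ)) (Φ+p+q≡1+n : Φ + (p + q) ≡ suc n) (1≤k : 1 ≤ k)
  (kN≡ed+t : k * N ≡ e * d + t) (t<N : t < N) (3dt<2N : 3 * (d * t) < 2 * N)
  (n< : n < 2 ^ (L * 1)) (e< : e < 2 ^ (L * 1)) (N< : N < 2 ^ (L * 2))
  where

  open Bounded L 1≤L
  open Euclid N d t 3dt<2N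

  L^-mono : ∀ {i j} → i ≤ j → L ^ i ≤ L ^ j
  L^-mono = ^-monoʳ-≤ L {{>-nonZero 1≤L}}

  module SearchLoop (s : ℕ) (s< : s < 2 ^ (L * 3)) where

    -- The bounds hold for every guessed sum `s`, since wrong guesses must be searched in bounded
    -- time too; only the location of `q` depends on `s` being right.
    record Inv (m : ℕ) (σ : State) : Set where
      field
        n≡    : σ rn ≡ n
        s≡    : σ rs ≡ s
        w<    : σ rw < 2 ^ m
        l+w≤s : σ rl + σ rw ≤ s
        q∈    : s ≡ p + q → σ rl ≤ q × q ≤ σ rl + σ rw × σ rl + σ rw < p

    open Inv

    l<2^ : ∀ {m σ} → Inv m σ → σ rl < 2 ^ (L * 3)
    l<2^ {σ = σ} inv = ≤-<-trans (≤-trans (m≤m+n (σ rl) (σ rw)) (l+w≤s inv)) s<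

    sizes : ∀ {m σ} → Inv m σ → Within searchSizes σ
    sizes {σ = σ} inv = within-∅
      ▸[ rn ↦ 1 ] subst (_< 2 ^ (L * 1)) (sym (n≡ inv)) n<
      ▸[ rs ↦ 3 ] subst (_< 2 ^ (L * 3)) (sym (s≡ inv)) s<
      ▸[ rw ↦ 3 ] ≤-<-trans (≤-trans (m≤n+m (σ rw) (σ rl)) (l+w≤s inv)) s<
      ▸[ rl ↦ 3 ] l<2^ inv

    step : ∀ {m σ} → Inv (suc m) σ → σ rw ≢ 0 → Inv m (exec searchStep σ)
    step {m} {σ} inv w≢0 = exec-if rv keepLower keepUpper (exec probe σ) (Inv m) lower upper
      where
      l = σ rl
      w = σ rw
      h = apply quot (w + 1) 2
      z = (l + h) * (σ rs ∸ (l + h)) ∸ σ rn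

      z≡ : s ≡ p + q → z ≡ (l + h) * (p + q ∸ (l + h)) ∸ p * q
      z≡ s≡p+q = cong₂ (λ x y → (l + h) * (x ∸ (l + h)) ∸ y) (trans (s≡ inv) s≡p+q) (trans (n≡ inv) n≡pq)

      l+h<p : s ≡ p + q → l + h < p
      l+h<p s≡p+q = ≤-<-trans (+-monoʳ-≤ l (half≤ w≢0)) (proj₂ (proj₂ (q∈ inv s≡p+q)))

      lower : z ≢ 0 → Inv m (exec keepLower (exec probe σ))
      lower z≢0 = record
        { n≡ = n≡ inv ; s≡ = s≡ inv
        ; w< = lower-half< w≢0 (w< inv)
        ; l+w≤s = ≤-trans l+h-1≤ (l+w≤s inv)
        ; q∈ = λ s≡p+q → proj₁ (q∈ inv s≡p+q)
            , ≤-pred (subst (suc q ≤_) (sym (trans (sym (+-suc l (h ∸ 1))) (cong (_+_ l) (m+[n∸m]≡n (half>0 w≢0)))))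
                (search-above (<⇒≤ q<p) (l+h<p s≡p+q) (z≢0 ∘ trans (z≡ s≡p+q))))
            , ≤-<-trans l+h-1≤ (proj₂ (proj₂ (q∈ inv s≡p+q))) }
        where
        l+h-1≤ : l + (h ∸ 1) ≤ l + w
        l+h-1≤ = +-monoʳ-≤ l (≤-trans (m∸n≤m h 1) (half≤ w≢0))

      upper : z ≡ 0 → Inv m (exec keepUpper (exec probe σ))
      upper z≡0 = record
        { n≡ = n≡ inv ; s≡ = s≡ inv
        ; w< = upper-half< w≢0 (w< inv)
        ; l+w≤s = subst (_≤ s) (sym l+h+w-h) (l+w≤s inv)
        ; q∈ = λ s≡p+q →
            search-below (<⇒≤ q<p) (l+h<p s≡p+q) (trans (sym (z≡ s≡p+q)) z≡0)
            , subst (q ≤_) (sym l+h+w-h) (proj₁ (proj₂ (q∈ inv s≡p+q)))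
            , subst (_< p) (sym l+h+w-h) (proj₂ (proj₂ (q∈ inv s≡p+q))) }
        where
        l+h+w-h : l + h + (w ∸ h) ≡ l + w
        l+h+w-h = trans (+-assoc l h (w ∸ h)) (cong (_+_ l) (m+[n∸m]≡n (half≤ w≢0)))

    search-runs : ∀ {σ} → Inv (L * 3) σ →
      Runs (whileNonZero rw searchStep) σ (searchWeight * L ^ 3)
        (λ τ → σ rq ≡ τ rq × τ rn ≡ n × τ rl < 2 ^ (L * 3) × (s ≡ p + q → τ rl ≡ q))
    search-runs inv = runs-weaken ≤-refl
      (λ {τ} ((_ , _ , inv′ , w≡0) , agree) → sym (agree rq) , n≡ inv′ , l<2^ inv′ , λ s≡p+q →
        let l≤q , q≤l+w , _ = q∈ inv′ s≡p+q in
        ≤-antisym l≤q (≤-trans q≤l+w (≤-reflexive (trans (cong (_+_ (τ rl)) w≡0) (+-identityʳ (τ rl))))))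
      -- The bisection writes only to registers from 10 on, so a factor already stored in `rq`
      -- (register 9) survives.
      (runs-preserving 10 (runs-while (weight searchStep searchSizes) 1 3 Inv w<
        (λ _ inv w≢0 → runs-weaken ≤-refl (λ { {τ} (refl , _) → step inv w≢0 }) (runs-exec searchStep (sizes inv)))
        inv))

  -- The alternatives are a fresh hit and an earlier one. A successful test can only store `q`, and
  -- a failed test rules out the fresh hit.
  accept-correct : ∀ σ → σ rn ≡ n → σ rl ≡ q ⊎ σ rq ≡ q → exec accept σ rq ≡ q
  accept-correct σ n≡ = exec-if ru (ifNonZero rv skip commit) skip σ′ Goal
    (λ good≢0 → exec-if rv skip commit σ′ Goal
      (λ rem≢0 → [ (λ l≡q → contradiction (rem≡0 l≡q) rem≢0) , id ]′)
      (λ rem≡0 _ → sound good≢0 rem≡0))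
    (λ good≡0 → [ (λ l≡q → contradiction good≡0 (good≢0 l≡q)) , id ]′)
    where
    σ′ = exec judge σ
    Goal = λ τ → σ rl ≡ q ⊎ σ rq ≡ q → τ rq ≡ q
    l = σ rl
    c = apply quot (σ rn) l
    1<q = prime>1 pq

    σn≡ : σ rn ≡ p * q
    σn≡ = trans n≡ n≡pq

    rem≡0 : l ≡ q → apply rem (σ rn) l ≡ 0
    rem≡0 refl = rem-multiple {y = l} p σn≡

    good≢0 : l ≡ q → (l ∸ 1) * (c ∸ l) ≢ 0
    good≢0 refl = m>n⇒m∸n≢0 (*-mono-≤ {1} {l ∸ 1} {1} (m<n⇒0<n∸m 1<q) (m<n⇒0<n∸m
      (subst (l <_) (sym (quot-unique p (<-trans z<s 1<q) σn≡)) q<p)))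

    sound : (l ∸ 1) * (c ∸ l) ≢ 0 → apply rem (σ rn) l ≡ 0 → l ≡ q
    sound good rem≡0 = smaller-factor pp pq q<p l 1<l l<c
      (trans (sym σn≡) (trans (quot-rem (σ rn) (m<n⇒n≢0 1<l)) (trans (cong (_+ c * l) rem≡0) (*-comm c l))))
      where
      1<l : 1 < l
      1<l = m∸n≢0⇒n<m λ eq → good (cong (_* (c ∸ l)) eq)
      l<c : l < c
      l<c = m∸n≢0⇒n<m λ eq → good (trans (cong ((l ∸ 1) *_) eq) (*-zeroʳ (l ∸ 1)))

  guessed : State → ℕ
  guessed σ = exec guessSum σ rs

  guessed-correct : ∀ σ → σ rn ≡ n → σ re ≡ e → σ rN ≡ N → σ rc ≡ d → guessed σ ≡ p + q
  guessed-correct σ n≡ e≡ N≡ c≡ rewrite n≡ | e≡ | N≡ | c≡ =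
    recover-sum {n} {e} {d} {k} {N} {t} {Φ} t<N kN≡ed+t 1≤k ed≡1+kΦ Φ+p+q≡1+n

  combine-try : ∀ a b c → a * L ^ 2 + (b * L ^ 3 + c * L ^ 2) ≤ (a + (b + c)) * L ^ 3
  combine-try a b c = ≤-trans
    (+-mono-≤ (*-monoʳ-≤ a L²≤L³) (+-monoʳ-≤ (b * L ^ 3) (*-monoʳ-≤ c L²≤L³)))
    (≤-reflexive (collect a b c (L ^ 3)))
    where
    L²≤L³ = L^-mono (n≤1+n 2)
    collect : ∀ a b c X → a * X + (b * X + c * X) ≡ (a + (b + c)) * X
    collect = solve-∀

  try-runs : ∀ σ → σ rn ≡ n → σ re ≡ e → σ rN ≡ N → σ rc ≤ N →
    Runs try σ (tryWeight * L ^ 3) (λ τ → (σ rc ≡ d ⊎ σ rq ≡ q → τ rq ≡ q) × Agree 9 σ τ)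
  -- Registers below 9 hold the inputs, `N` and the two vectors; no attempt touches them.
  try-runs σ n≡ e≡ N≡ c≤N = runs-preserving 9
    (runs-weaken (combine-try (weight guessSum candidateSizes) searchWeight (weight accept acceptSizes)) id
      (runs-seq (runs-exec guessSum sizes) λ { (refl , w) → runs-seq (search w)
        λ { {τ} (q≡ , n≡′ , l< , l≡) → runs-weaken ≤-refl
          (λ { (refl , _) → [ (λ c≡d → accept-correct τ n≡′ (inj₁ (l≡ (guessed-correct σ n≡ e≡ N≡ c≡d))))
                            , (λ σq≡q → accept-correct τ n≡′ (inj₂ (trans (sym q≡) σq≡q))) ]′ })
          (runs-exec accept (within-∅ ▸[ rn ↦ 1 ] subst (_< 2 ^ (L * 1)) (sym n≡′) n< ▸[ rl ↦ 3 ] l<)) } }))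
    where
    sizes : Within candidateSizes σ
    sizes = within-∅
      ▸[ rn ↦ 1 ] subst (_< 2 ^ (L * 1)) (sym n≡) n<
      ▸[ re ↦ 1 ] subst (_< 2 ^ (L * 1)) (sym e≡) e<
      ▸[ rN ↦ 2 ] subst (_< 2 ^ (L * 2)) (sym N≡) N<
      ▸[ rc ↦ 2 ] ≤-<-trans c≤N N<
    s = guessed σ
    half = apply quot s 2
    s≡ : s ≡ apply rem s 2 + half * 2
    s≡ = quot-rem s {2} λ ()

    -- Starting from half the sum keeps every probe below `p`, the larger root of
    -- `m (p + q − m) = p q`, where the comparison decides correctly.
    half<p : s ≡ p + q → half < p
    half<p s≡p+q = *-cancelʳ-< 2 half p (≤-<-trans (quot*≤ s 2)
      (subst₂ _<_ (sym s≡p+q) (trans (cong (_+_ p) (sym (+-identityʳ p))) (*-comm 2 p)) (+-monoʳ-< p q<p)))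

    q≤half : s ≡ p + q → q ≤ half
    q≤half s≡p+q = *-cancelʳ-≤ q half 2 (≤-pred (begin-strict
      q * 2                        ≡⟨ *-comm q 2 ⟩
      q + (q + 0)                  ≡⟨ cong (_+_ q) (+-identityʳ q) ⟩
      q + q                        <⟨ +-monoˡ-< q q<p ⟩
      p + q                        ≡⟨ s≡p+q ⟨
      s                            ≡⟨ s≡ ⟩
      apply rem s 2 + half * 2     ≤⟨ +-monoˡ-≤ (half * 2) (≤-pred (rem< s {2} λ ())) ⟩
      suc (half * 2)               ∎))
      where open ≤-Reasoning

    search : Within (resize guessSum candidateSizes) (exec guessSum σ) →
      Runs (whileNonZero rw searchStep) (exec guessSum σ) (searchWeight * L ^ 3)
        (λ τ → σ rq ≡ τ rq × τ rn ≡ n × τ rl < 2 ^ (L * 3) × (s ≡ p + q → τ rl ≡ q))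
    search w = SearchLoop.search-runs s (bound w rs refl) record
      { n≡ = n≡ ; s≡ = refl ; w< = bound w rw refl ; l+w≤s = quot≤ s 2
      ; q∈ = λ s≡p+q → z≤n , q≤half s≡p+q , half<p s≡p+q }

  -- All terms of `det` are nonnegative, so it also bounds `d₁`, and `d₂` while `t₁` is nonzero, by
  -- `N`; this gives their sizes. Register contents are parameters so that `rewrite` can carry the
  -- record from one state to another.
  record Basis (b n′ e′ N′ d₁ t₁ d₂ t₂ : ℕ) : Set where
    field
      n≡   : n′ ≡ n
      e≡   : e′ ≡ e
      N≡   : N′ ≡ N
      t₁<  : t₁ < b
      1≤t₂ : 1 ≤ t₂
      t₂<  : t₂ < 2 ^ (L * 2)
      det  : N ≡ t₁ * d₂ + t₂ * d₁

  open Basis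

  d₁≤N : ∀ {b n′ e′ N′ d₁ t₁ d₂ t₂} → Basis b n′ e′ N′ d₁ t₁ d₂ t₂ → d₁ ≤ N
  d₁≤N {d₁ = d₁} {t₁} {d₂} {t₂} bs = begin
    d₁                    ≤⟨ m≤n*m d₁ t₂ {{>-nonZero (1≤t₂ bs)}} ⟩
    t₂ * d₁               ≤⟨ m≤n+m (t₂ * d₁) (t₁ * d₂) ⟩
    t₁ * d₂ + t₂ * d₁     ≡⟨ det bs ⟨
    N                     ∎
    where open ≤-Reasoning

  d₁+d₂≤N : ∀ {b n′ e′ N′ d₁ t₁ d₂ t₂} → t₁ ≢ 0 → Basis b n′ e′ N′ d₁ t₁ d₂ t₂ → d₁ + d₂ ≤ N
  d₁+d₂≤N {d₁ = d₁} {t₁} {d₂} {t₂} t₁≢0 bs = begin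
    d₁ + d₂               ≡⟨ +-comm d₁ d₂ ⟩
    d₂ + d₁               ≤⟨ +-mono-≤ (m≤n*m d₂ t₁ {{≢-nonZero t₁≢0}}) (m≤n*m d₁ t₂ {{>-nonZero (1≤t₂ bs)}}) ⟩
    t₁ * d₂ + t₂ * d₁     ≡⟨ det bs ⟨
    N                     ∎
    where open ≤-Reasoning

  BasisAt : ℕ → State → Set
  BasisAt m σ = Basis (2 ^ m) (σ rn) (σ re) (σ rN) (σ rd₁) (σ rt₁) (σ rd₂) (σ rt₂)

  PendingAt : State → Set
  PendingAt σ = Pending (σ rd₁) (σ rt₁) (σ rd₂) (σ rt₂)

  basis-agree : ∀ m σ τ → Agree 9 σ τ → BasisAt m σ → BasisAt m τ
  basis-agree m σ τ agree bs rewrite agree rn {_} | agree re {_} | agree rN {_} | agree rd₁ {_} | agree rt₁ {_} | agree rd₂ {_} | agree rt₂ {_} = bs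

  pending-agree : ∀ σ τ → Agree 9 σ τ → PendingAt σ → PendingAt τ
  pending-agree σ τ agree h rewrite agree rd₁ {_} | agree rt₁ {_} | agree rd₂ {_} | agree rt₂ {_} = h

  basis-sizes : ∀ m σ → m ≤ L * 2 → σ rt₁ ≢ 0 → BasisAt m σ → Within basisSizes σ
  basis-sizes m σ m≤ t₁≢0 bs = within-∅
    ▸[ rd₁ ↦ 2 ] ≤-<-trans (d₁≤N bs) N<
    ▸[ rt₁ ↦ 2 ] <-≤-trans (t₁< bs) (^-monoʳ-≤ 2 m≤)
    ▸[ rd₂ ↦ 2 ] ≤-<-trans (≤-trans (m≤n+m (σ rd₂) (σ rd₁)) (d₁+d₂≤N t₁≢0 bs)) N<
    ▸[ rt₂ ↦ 2 ] t₂< bs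

  module Under {m σ} (t₁≢0 : σ rt₁ ≢ 0) (bs : BasisAt m σ) where

    σ′ = exec reduceUnder σ

    private
      u = apply quot (σ rt₂ ∸ 1) (σ rt₁)
      r = σ rt₂ ∸ u * σ rt₁
      1≤r = proj₁ (ceiling-step t₁≢0 (1≤t₂ bs))
      t₂≡ : σ rt₂ ≡ r + u * σ rt₁
      t₂≡ = proj₂ (proj₂ (ceiling-step t₁≢0 (1≤t₂ bs)))

    t₂≤t₁ : σ′ rt₂ ≤ σ′ rt₁
    t₂≤t₁ = proj₁ (proj₂ (ceiling-step t₁≢0 (1≤t₂ bs)))

    basis : BasisAt m σ′
    basis = record
      { n≡ = n≡ bs ; e≡ = e≡ bs ; N≡ = N≡ bs ; t₁< = t₁< bs
      ; 1≤t₂ = 1≤r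
      ; t₂< = ≤-<-trans (m∸n≤m (σ rt₂) (u * σ rt₁)) (t₂< bs)
      ; det = trans (det bs) (trans (cong (λ z → σ rt₁ * σ rd₂ + z * σ rd₁) t₂≡)
          (rearrange (σ rt₁) (σ rd₂) r u (σ rd₁))) }
      where
      rearrange : ∀ t₁ d₂ r u d₁ → t₁ * d₂ + (r + u * t₁) * d₁ ≡ t₁ * (d₂ + u * d₁) + r * d₁
      rearrange = solve-∀

    pending : PendingAt σ → PendingAt σ′
    pending h = pending-under u 1≤r (subst (Pending (σ rd₁) (σ rt₁) (σ rd₂)) t₂≡ h)

  module Over {m σ} (t₂≤t₁ : σ rt₂ ≤ σ rt₁) (bs : BasisAt (suc m) σ) where

    σ′ = exec reduceOver σ

    private
      u = apply quot (σ rt₁) (σ rt₂)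
      r = apply rem (σ rt₁) (σ rt₂)
      t₁≡ : σ rt₁ ≡ r + u * σ rt₂
      t₁≡ = quot-rem (σ rt₁) (m<n⇒n≢0 (1≤t₂ bs))
      N≡′ : N ≡ (r + u * σ rt₂) * σ rd₂ + σ rt₂ * σ rd₁
      N≡′ = trans (det bs) (cong (λ z → z * σ rd₂ + σ rt₂ * σ rd₁) t₁≡)

    basis : BasisAt m σ′
    basis = record
      { n≡ = n≡ bs ; e≡ = e≡ bs ; N≡ = N≡ bs
      -- `t₂ ≤ t₁`, left behind by the preceding reduction of `v`, makes the quotient positive, so
      -- `t₁` loses a bit.
      ; t₁< = rem-halves (1≤t₂ bs) t₂≤t₁ (t₁< bs)
      ; 1≤t₂ = 1≤t₂ bs ; t₂< = t₂< bs
      ; det = trans N≡′ (rearrange r u (σ rt₂) (σ rd₂) (σ rd₁)) }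
      where
      rearrange : ∀ r u t₂ d₂ d₁ → (r + u * t₂) * d₂ + t₂ * d₁ ≡ r * d₂ + t₂ * (d₁ + u * d₂)
      rearrange = solve-∀

    pending : PendingAt σ → σ rd₁ + σ rd₂ ≡ d ⊎ σ′ rc ≡ d ⊎ PendingAt σ′
    pending h = pending-over u N≡′ (subst (λ z → Pending (σ rd₁) z (σ rd₂) (σ rt₂)) t₁≡ h)

  LoopInv : ℕ → State → Set
  LoopInv m σ = BasisAt m σ × (σ rq ≡ q ⊎ PendingAt σ)

  combine-round : ∀ a b c → a * L ^ 2 + (b * L ^ 3 + (c * L ^ 2 + b * L ^ 3)) ≤ (a + (b + (c + b))) * L ^ 3
  combine-round a b c = ≤-trans
    (+-mono-≤ (*-monoʳ-≤ a L²≤L³) (+-monoʳ-≤ (b * L ^ 3) (+-monoˡ-≤ (b * L ^ 3) (*-monoʳ-≤ c L²≤L³))))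
    (≤-reflexive (collect a b c (L ^ 3)))
    where
    L²≤L³ = L^-mono (n≤1+n 2)
    collect : ∀ a b c X → a * X + (b * X + (c * X + b * X)) ≡ (a + (b + (c + b))) * X
    collect = solve-∀

  record AfterUnder (m : ℕ) (σ : State) : Set where
    field
      basis  : BasisAt m σ
      t₁≢0   : σ rt₁ ≢ 0
      t₂≤t₁  : σ rt₂ ≤ σ rt₁
      c≡     : σ rc ≡ σ rd₁ + σ rd₂
      found  : σ rq ≡ q ⊎ PendingAt σ

  -- The field `tried` remembers the test of `d₁ + d₂` until `pending-over`, which may answer that
  -- this sum was `d`.
  record AfterFirstTry (m : ℕ) (σ : State) : Set where
    field
      basis  : BasisAt m σ
      t₁≢0   : σ rt₁ ≢ 0
      t₂≤t₁  : σ rt₂ ≤ σ rt₁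
      tried  : σ rd₁ + σ rd₂ ≡ d → σ rq ≡ q
      found  : σ rq ≡ q ⊎ PendingAt σ

  record AfterOver (m : ℕ) (σ : State) : Set where
    field
      basis  : BasisAt m σ
      c≡     : σ rc ≡ σ rd₁
      found  : σ rq ≡ q ⊎ σ rc ≡ d ⊎ PendingAt σ

  under-runs : ∀ m σ → m ≤ L * 2 → LoopInv m σ → σ rt₁ ≢ 0 →
    Runs reduceUnder σ (weight reduceUnder basisSizes * L ^ 2) (AfterUnder m)
  under-runs m σ m≤ (bs , found) t₁≢0 = runs-weaken ≤-refl (λ { (refl , _) → after })
    (runs-exec reduceUnder (basis-sizes m σ m≤ t₁≢0 bs))
    where
    module U = Under {m} {σ} t₁≢0 bs
    after : AfterUnder m (exec reduceUnder σ)
    after = record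
      { basis = U.basis ; t₁≢0 = t₁≢0 ; t₂≤t₁ = U.t₂≤t₁ ; c≡ = refl ; found = Sum.map₂ U.pending found }

  first-try-runs : ∀ m σ → AfterUnder m σ → Runs try σ (tryWeight * L ^ 3) (AfterFirstTry m)
  first-try-runs m σ au = runs-weaken ≤-refl (λ {τ} (hit , agree) → after τ hit agree)
    (try-runs σ (n≡ basis) (e≡ basis) (N≡ basis) (subst (_≤ N) (sym c≡) (d₁+d₂≤N t₁≢0 basis)))
    where
    open AfterUnder au
    after : ∀ τ → (σ rc ≡ d ⊎ σ rq ≡ q → τ rq ≡ q) → Agree 9 σ τ → AfterFirstTry m τ
    after τ hit agree = record
      { basis = basis-agree m σ τ agree basis
      ; t₁≢0 = λ t₁≡0 → t₁≢0 (trans (sym (agree rt₁)) t₁≡0)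
      ; t₂≤t₁ = subst₂ _≤_ (sym (agree rt₂)) (sym (agree rt₁)) t₂≤t₁
      ; tried = λ eq → hit (inj₁ (trans c≡ (trans (cong₂ _+_ (sym (agree rd₁)) (sym (agree rd₂))) eq)))
      ; found = Sum.map (hit ∘ inj₂) (pending-agree σ τ agree) found }

  over-runs : ∀ m σ → suc m ≤ L * 2 → AfterFirstTry (suc m) σ →
    Runs reduceOver σ (weight reduceOver basisSizes * L ^ 2) (AfterOver m)
  over-runs m σ m< at = runs-weaken ≤-refl (λ { (refl , _) → after })
    (runs-exec reduceOver (basis-sizes (suc m) σ m< t₁≢0 basis))
    where
    open AfterFirstTry at
    module O = Over {m} {σ} t₂≤t₁ basis
    resolve : σ rq ≡ q ⊎ PendingAt σ → σ rq ≡ q ⊎ O.σ′ rc ≡ d ⊎ PendingAt O.σ′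
    resolve (inj₁ q≡) = inj₁ q≡
    resolve (inj₂ h)  = Sum.map₁ tried (O.pending h)
    after : AfterOver m (exec reduceOver σ)
    after = record { basis = O.basis ; c≡ = refl ; found = resolve found }

  second-try-runs : ∀ m σ → AfterOver m σ → Runs try σ (tryWeight * L ^ 3) (LoopInv m)
  second-try-runs m σ ao = runs-weaken ≤-refl (λ {τ} (hit , agree) → after τ hit agree)
    (try-runs σ (n≡ basis) (e≡ basis) (N≡ basis) (subst (_≤ N) (sym c≡) (d₁≤N basis)))
    where
    open AfterOver ao
    after : ∀ τ → (σ rc ≡ d ⊎ σ rq ≡ q → τ rq ≡ q) → Agree 9 σ τ → LoopInv m τ
    after τ hit agree = basis-agree m σ τ agree basis ,
      [ inj₁ ∘ hit ∘ inj₂ , Sum.map (hit ∘ inj₁) (pending-agree σ τ agree) ]′ found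

  round-runs : ∀ m σ → suc m ≤ L * 2 → LoopInv (suc m) σ → σ rt₁ ≢ 0 →
    Runs (reduceUnder ⨾ try ⨾ reduceOver ⨾ try) σ (roundWeight * L ^ 3) (LoopInv m)
  round-runs m σ m< inv t₁≢0 = runs-weaken
    (combine-round (weight reduceUnder basisSizes) tryWeight (weight reduceOver basisSizes)) id
    (runs-seq (under-runs (suc m) σ m< inv t₁≢0) λ {τ₁} h₁ →
      runs-seq (first-try-runs (suc m) τ₁ h₁) λ {τ₂} h₂ →
      runs-seq (over-runs m τ₂ m< h₂) λ {τ₃} h₃ → second-try-runs m τ₃ h₃)

  combine-total : ∀ a b c f → a * L ^ 2 + (b * L ^ 2 + (c * L ^ 4 + f * L ^ 2)) ≤ (a + (b + (c + f))) * L ^ 4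
  combine-total a b c f = ≤-trans
    (+-mono-≤ (*-monoʳ-≤ a L²≤L⁴) (+-mono-≤ (*-monoʳ-≤ b L²≤L⁴) (+-monoʳ-≤ (c * L ^ 4) (*-monoʳ-≤ f L²≤L⁴))))
    (≤-reflexive (collect a b c f (L ^ 4)))
    where
    L²≤L⁴ = L^-mono {2} {4} (s≤s (s≤s z≤n))
    collect : ∀ a b c f X → a * X + (b * X + (c * X + f * X)) ≡ (a + (b + (c + f))) * X
    collect = solve-∀

  ed≢0 : e * d ≢ 0
  ed≢0 ed≡0 = 1+n≢0 (trans (sym ed≡1+kΦ) ed≡0)

  1≤e : 1 ≤ e
  1≤e = n≢0⇒n>0 λ e≡0 → ed≢0 (cong (_* d) e≡0)

  1≤d : 1 ≤ d
  1≤d = n≢0⇒n>0 λ d≡0 → ed≢0 (trans (cong (e *_) d≡0) (*-zeroʳ e))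

  -- The initial vectors are `u = (0 , N)` and `v = (1 , − e)`, and `k N = e d + t` reads
  -- `(d , t) = k u + d v`.
  start-inv : ∀ σ → σ rn ≡ n → σ re ≡ e → σ rN ≡ N → LoopInv (L * 2) (exec start σ)
  start-inv σ n≡ e≡ N≡ = basis , inj₂ (k , d , 1≤k , 1≤d , coordinates)
    where
    basis : BasisAt (L * 2) (exec start σ)
    basis = record
      { n≡ = n≡ ; e≡ = e≡ ; N≡ = N≡
      ; t₁< = subst (_< 2 ^ (L * 2)) (sym N≡) N<
      ; 1≤t₂ = subst (1 ≤_) (sym e≡) 1≤e
      ; t₂< = subst (_< 2 ^ (L * 2)) (sym e≡) (<-≤-trans e< (2^L-mono (n≤1+n 1)))
      ; det = trans (sym N≡) (sym (trans (cong₂ _+_ (*-identityʳ (σ rN)) (*-zeroʳ (σ re))) (+-identityʳ (σ rN)))) }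

    coordinates : Coordinates k d 0 (σ rN) 1 (σ re)
    coordinates = record
      -- A common divisor of `k` and `d` divides `e d − k Φ = 1`.
      { coprime = λ {i} (i∣k , i∣d) → ∣1⇒≡1 (∣m+n∣m⇒∣n
          (subst (i ∣_) (trans ed≡1+kΦ (+-comm 1 (k * Φ))) (∣n⇒∣m*n e i∣d)) (∣m⇒∣m*n Φ i∣k))
      ; d≡ = sym (cong₂ _+_ (*-zeroʳ k) (*-identityʳ d))
      ; t≡ = trans (cong (λ z → t + d * z) e≡)
          (trans (trans (+-comm t (d * e)) (cong (_+ t) (*-comm d e)))
            (trans (sym kN≡ed+t) (cong (k *_) (sym N≡)))) }

  output-runs : ∀ m σ → LoopInv m σ → σ rt₁ ≡ 0 →
    Runs output σ (weight output outputSizes * L ^ 2) (λ τ → τ 0 ≡ p × τ 1 ≡ q)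
  output-runs m σ (bs , found) t₁≡0 = runs-weaken ≤-refl
    (λ { (refl , _) → trans (cong (apply quot (σ rn)) q≡) (quot-unique p (<-trans z<s (prime>1 pq)) (trans (n≡ bs) n≡pq)) , q≡ })
    (runs-exec output (within-∅
      ▸[ rn ↦ 1 ] subst (_< 2 ^ (L * 1)) (sym (n≡ bs)) n<
      ▸[ rq ↦ 1 ] subst (_< 2 ^ (L * 1)) (sym q≡) (≤-<-trans q≤n n<)))
    where
    q≤n : q ≤ n
    q≤n = subst (q ≤_) (sym n≡pq) (m≤n*m q p {{prime⇒nonZero pp}})
    q≡ : σ rq ≡ q
    q≡ = [ id , (λ h → contradiction (subst (λ z → Pending (σ rd₁) z (σ rd₂) (σ rt₂)) t₁≡0 h) (not-pending (1≤t₂ bs))) ]′ found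

  record AfterInput (σ : State) : Set where
    field
      n≡ : σ rn ≡ n
      e≡ : σ re ≡ e
      N≡ : σ rN ≡ N

  input-runs : ∀ x → signBit x < 2 ^ (L * 1) → ℤ.∣ x ∣ < 2 ^ (L * 2) →
    exec subtractInput (input n e x) rN ≡ N →
    Runs subtractInput (input n e x) (weight subtractInput inputSizes * L ^ 2) AfterInput
  input-runs x sign< abs< N≡ = runs-weaken ≤-refl
    (λ ((σ≡ , _) , agree) → record { n≡ = agree rn ; e≡ = agree re ; N≡ = trans (cong (λ τ → τ rN) σ≡) N≡ })
    (runs-preserving 4 (runs-exec subtractInput
      (within-∅ ▸[ rn ↦ 1 ] n< ▸[ re ↦ 1 ] e< ▸[ rsign ↦ 1 ] sign< ▸[ rabs ↦ 2 ] abs<)))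

  start-runs : ∀ σ → AfterInput σ → Runs start σ (weight start startSizes * L ^ 2) (LoopInv (L * 2))
  start-runs σ ai = runs-weaken ≤-refl (λ { (refl , _) → start-inv σ (AfterInput.n≡ ai) (AfterInput.e≡ ai) (AfterInput.N≡ ai) })
    (runs-exec start (within-∅
      ▸[ re ↦ 1 ] subst (_< 2 ^ (L * 1)) (sym (AfterInput.e≡ ai)) e<
      ▸[ rN ↦ 2 ] subst (_< 2 ^ (L * 2)) (sym (AfterInput.N≡ ai)) N<))

  loop-runs : ∀ σ → LoopInv (L * 2) σ →
    Runs (whileNonZero rt₁ (reduceUnder ⨾ try ⨾ reduceOver ⨾ try)) σ (loopWeight * L ^ 4)
      (λ τ → ∃ λ m → m ≤ L * 2 × LoopInv m τ × τ rt₁ ≡ 0)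
  loop-runs σ = runs-while roundWeight 2 2 LoopInv (t₁< ∘ proj₁) (λ {m} {σ} → round-runs m σ)

  algorithm-runs : ∀ x → signBit x < 2 ^ (L * 1) → ℤ.∣ x ∣ < 2 ^ (L * 2) →
    exec subtractInput (input n e x) rN ≡ N →
    Runs algorithm (input n e x) (totalWeight * L ^ 4) (λ τ → τ 0 ≡ p × τ 1 ≡ q)
  algorithm-runs x sign< abs< N≡ = runs-weaken
    (combine-total (weight subtractInput inputSizes) (weight start startSizes) loopWeight (weight output outputSizes)) id
    (runs-seq (input-runs x sign< abs< N≡) λ {σ₁} h₁ →
      runs-seq (start-runs σ₁ h₁) λ {σ₂} h₂ →
      runs-seq (loop-runs σ₂ h₂) λ {σ₃} (m , _ , inv , t₁≡0) → output-runs m σ₃ inv t₁≡0)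

-- From the hypotheses of the theorem to integer inequalities

-- The difference of the two sides factors as `(2q − p) (2p − q)`, that is `j (3i + j)` with
-- `i = p − q` and `j = 2q − p`.
2[p+q]²<9pq : ∀ {p q} → q < p → p < 2 * q → 2 * ((p + q) * (p + q)) < 9 * (p * q)
2[p+q]²<9pq {p} {q} q<p p<2q = begin-strict
  2 * ((p + q) * (p + q))                                     ≡⟨ cong₂ (λ x y → 2 * ((x + y) * (x + y))) p≡ q≡ ⟩
  2 * ((i + j + i + (i + j)) * (i + j + i + (i + j)))         <⟨ m<m+n _ (<-≤-trans (*-mono-≤ 1≤j 1≤j) (m≤n+m (j * j) (3 * (i * j)))) ⟩
  2 * ((i + j + i + (i + j)) * (i + j + i + (i + j))) + (3 * (i * j) + j * j) ≡⟨ rearrange i j ⟩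
  9 * ((i + j + i) * (i + j))                                 ≡⟨ cong₂ (λ x y → 9 * (x * y)) p≡ q≡ ⟨
  9 * (p * q)                                                 ∎
  where
  open ≤-Reasoning
  i = p ∸ q
  j = 2 * q ∸ p
  1≤j : 1 ≤ j
  1≤j = m<n⇒0<n∸m p<2q
  q+i≡p : q + i ≡ p
  q+i≡p = m+[n∸m]≡n (<⇒≤ q<p)
  q≡ : q ≡ i + j
  q≡ = +-cancelˡ-≡ q q (i + j) (trans (cong (_+_ q) (sym (+-identityʳ q)))
    (trans (sym (m+[n∸m]≡n (<⇒≤ p<2q))) (trans (cong (_+ j) (sym q+i≡p)) (+-assoc q i j))))
  p≡ : p ≡ i + j + i
  p≡ = trans (sym q+i≡p) (cong (_+ i) q≡)
  rearrange : ∀ i j → 2 * ((i + j + i + (i + j)) * (i + j + i + (i + j))) + (3 * (i * j) + j * j) ≡ 9 * ((i + j + i) * (i + j))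
  rearrange = solve-∀

i≡[i-j]+j : ∀ i j → i ≡ i ℤ.- j ℤ.+ j
i≡[i-j]+j i j = sym (trans (ℤ.+-assoc i (ℤ.- j) j) (trans (cong (λ z → i ℤ.+ z) (ℤ.+-inverseˡ j)) (ℤ.+-identityʳ i)))

-- Applied to `m = e d > 1`: `k = 0` would give `m = 1`, and a negative `k` would give `m ≤ 1`.
natural-k : ∀ {m Φ} k → 1 < m → + m ℤ.- k ℤ.* + Φ ≡ 1ℤ → ∃ λ j → 1 ≤ j × m ≡ suc (j * Φ)
natural-k {m} {Φ} (+ j) 1<m eq = j , n≢0⇒n>0 j≢0 , m≡
  where
  open ≡-Reasoning
  m≡ : m ≡ suc (j * Φ)
  m≡ = ℤ.+-injective (begin
    + m                                       ≡⟨ i≡[i-j]+j (+ m) (+ j ℤ.* + Φ) ⟩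
    + m ℤ.- + j ℤ.* + Φ ℤ.+ + j ℤ.* + Φ       ≡⟨ cong (ℤ._+ + j ℤ.* + Φ) eq ⟩
    1ℤ ℤ.+ + j ℤ.* + Φ                        ≡⟨ cong (ℤ._+_ (1ℤ)) (ℤ.pos-* j Φ) ⟨
    + suc (j * Φ)                             ∎)
  j≢0 : j ≢ 0
  j≢0 refl = <⇒≢ 1<m (sym m≡)
natural-k {m} {Φ} -[1+ j ] 1<m eq = contradiction 1<m (≤⇒≯ (≤-trans (m≤m+n m (suc j * Φ)) (≤-reflexive (ℤ.+-injective (begin
  + m ℤ.+ + (suc j * Φ)                       ≡⟨ cong (ℤ._+_ (+ m)) (ℤ.pos-* (suc j) Φ) ⟩
  + m ℤ.+ + suc j ℤ.* + Φ                     ≡⟨ cong (ℤ._+_ (+ m)) (ℤ.neg-involutive (+ suc j ℤ.* + Φ)) ⟨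
  + m ℤ.- ℤ.- (+ suc j ℤ.* + Φ)               ≡⟨ cong (λ z → + m ℤ.- z) (ℤ.neg-distribˡ-* (+ suc j) (+ Φ)) ⟩
  + m ℤ.- -[1+ j ] ℤ.* + Φ                    ≡⟨ eq ⟩
  1ℤ                                          ∎)))))
  where open ≡-Reasoning

-- `n = Φ + (p + q − 1)` gives `n − x = Φ + R`. For `x ≥ 0` this reads `n = Φ + R + x`, so `monus`
-- does not truncate and `x ≤ n`; for `x < 0` the absolute value is a summand of `Φ + R`.
subtractInput-correct : ∀ {n Φ s R e} x → Φ + s ≡ suc n → + s ℤ.- 1ℤ ≡ x ℤ.+ + R →
  exec subtractInput (input n e x) rN ≡ Φ + R × (ℤ.∣ x ∣ ≤ n ⊎ ℤ.∣ x ∣ ≤ Φ + R)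
subtractInput-correct {n} {Φ} {s} {R} (+ m) Φ+s≡ eq =
  trans (cong (_∸ m) n≡) (m+n∸n≡m (Φ + R) m) , inj₁ (subst (m ≤_) (sym n≡) (m≤n+m m (Φ + R)))
  where
  open ≡-Reasoning
  s≡ : s ≡ suc (m + R)
  s≡ = ℤ.+-injective (begin
    + s                          ≡⟨ i≡[i-j]+j (+ s) 1ℤ ⟩
    + s ℤ.- 1ℤ ℤ.+ 1ℤ            ≡⟨ cong (ℤ._+ 1ℤ) eq ⟩
    + (m + R + 1)                ≡⟨ cong (λ z → + z) (+-comm (m + R) 1) ⟩
    + suc (m + R)                ∎)
  n≡ : n ≡ Φ + R + m
  n≡ = suc-injective (trans (sym Φ+s≡) (trans (cong (_+_ Φ) s≡) (rearrange Φ m R)))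
    where
    rearrange : ∀ Φ m R → Φ + (1 + (m + R)) ≡ 1 + (Φ + R + m)
    rearrange = solve-∀
subtractInput-correct {n} {Φ} {s} {R} -[1+ j ] Φ+s≡ eq =
  N≡ , inj₂ (subst (suc j ≤_) N≡ (m≤n+m (suc j) n))
  where
  open ≡-Reasoning
  s+j≡ : s + suc j ≡ suc R
  s+j≡ = ℤ.+-injective (begin
    + s ℤ.+ + suc j                                    ≡⟨ cong (ℤ._+ + suc j) (i≡[i-j]+j (+ s) 1ℤ) ⟩
    + s ℤ.- 1ℤ ℤ.+ 1ℤ ℤ.+ + suc j                      ≡⟨ cong (λ z → z ℤ.+ 1ℤ ℤ.+ + suc j) eq ⟩
    -[1+ j ] ℤ.+ + R ℤ.+ 1ℤ ℤ.+ + suc j                ≡⟨ cong (ℤ._+ + suc j) (ℤ.+-assoc -[1+ j ] (+ R) 1ℤ) ⟩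
    -[1+ j ] ℤ.+ (+ (R + 1)) ℤ.+ + suc j               ≡⟨ ℤ.+-comm (-[1+ j ] ℤ.+ + (R + 1)) (+ suc j) ⟩
    + suc j ℤ.+ (-[1+ j ] ℤ.+ + (R + 1))               ≡⟨ ℤ.+-assoc (+ suc j) -[1+ j ] (+ (R + 1)) ⟨
    + suc j ℤ.+ -[1+ j ] ℤ.+ + (R + 1)                 ≡⟨ cong (ℤ._+ + (R + 1)) (ℤ.+-inverseʳ (+ suc j)) ⟩
    + (R + 1)                                          ≡⟨ cong (λ z → + z) (+-comm R 1) ⟩
    + suc R                                            ∎)
  N≡ : n + suc j ≡ Φ + R
  N≡ = suc-injective (begin
    suc n + suc j                ≡⟨ cong (_+ suc j) Φ+s≡ ⟨
    Φ + s + suc j                ≡⟨ +-assoc Φ s (suc j) ⟩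
    Φ + (s + suc j)              ≡⟨ cong (_+_ Φ) s+j≡ ⟩
    Φ + suc R                    ≡⟨ +-suc Φ R ⟩
    suc (Φ + R)                  ∎)

theorem3p1 : Σ[ algorithm ∈ Program ] Σ[ bound ∈ Polynomial ]
    ((p q n e d R : ℕ) (k x : ℤ) →
    Prime p → Prime q → q < p → p < 2 * q → n ≡ p * q →
    (1<e : 1 < e) → Coprime e (φ n) →
    1 ≤ d → d < φ n → + (e * d) ℤ.- k ℤ.* + φ n ≡ 1ℤ →
    + (p + q) ℤ.- 1ℤ ≡ x ℤ.+ + R → (0<R : 0 < R) →
    natᵣ d <ᵣ (√ (+ 2 / 3) *ᵣ natᵣ n -ᵣ √ (+ (3 * n) / 1))
    *ᵣ ((e * R) ^-½) {{m*n≢0 e R {{>-nonZero (<-trans z<s 1<e)}} {{>-nonZero 0<R}}}} →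
    ∃[ final ] ∃[ time ]
    (algorithm , input n e x ⇓ final [ time ] ×
    final 0 ≡ p × final 1 ≡ q ×
    time ≤ eval bound ⌈log₂ (e * n) ⌉))
theorem3p1 = algorithm , bound , λ { p q n e d R k x pp pq q<p p<2q refl 1<e _ 1≤d _ k-eq x-eq 0<R real →
    let instance
          e≢0 : NonZero e
          e≢0 = >-nonZero (<-trans z<s 1<e)
          R≢0 : NonZero R
          R≢0 = >-nonZero 0<R
          eR≢0 : NonZero (e * R)
          eR≢0 = m*n≢0 e R
        k′ , 1≤k , ed≡ = natural-k k (*-mono-≤ 1<e 1≤d) k-eq
        runs s t (p≡ , q≡) = main p q e d R k′ x pp pq q<p 1<e 1≤d 1≤k ed≡ 0<R x-eq
          (proj₂ (hypothesis-bound {d} {p * q} {p + q} (2[p+q]²<9pq q<p p<2q) (*-mono-≤ (<⇒≤ (prime>1 pp)) (<⇒≤ (prime>1 pq))) real))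
    in _ , _ , s , p≡ , q≡ , ≤-trans t (≤-reflexive (sym (eval-bound totalWeight ⌈log₂ (e * (p * q)) ⌉))) }
  where
  bound : Polynomial
  -- Degree 4: two for an instruction on numbers of `O(L)` bits, one for the bisection and one for
  -- the Euclidean loop.
  bound = 0 ∷ 0 ∷ 0 ∷ 0 ∷ totalWeight ∷ []

  eval-bound : ∀ w L → eval (0 ∷ 0 ∷ 0 ∷ 0 ∷ w ∷ []) L ≡ w * L ^ 4
  eval-bound = expand
    where
    expand : ∀ w L → 0 + L * (0 + L * (0 + L * (0 + L * (w + L * 0)))) ≡ w * (L * (L * (L * (L * 1))))
    expand = solve-∀

  main : ∀ p q e d R k x → Prime p → Prime q → q < p → 1 < e → 1 ≤ d → 1 ≤ k →
    e * d ≡ suc (k * φ (p * q)) → 0 < R → + (p + q) ℤ.- 1ℤ ≡ x ℤ.+ + R →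
    3 * (e * R * (d * d)) < 2 * ((p * q ∸ (p + q)) * (p * q ∸ (p + q))) →
    Runs algorithm (input (p * q) e x) (totalWeight * ⌈log₂ (e * (p * q)) ⌉ ^ 4) (λ τ → τ 0 ≡ p × τ 1 ≡ q)
  main p q e d R k x pp pq q<p 1<e 1≤d 1≤k ed≡ 0<R x-eq bound =
    Verification.algorithm-runs L p q n e d k N t Φ 1≤L pp pq q<p refl ed≡ Φ+s≡ 1≤k kN≡ t<N 3dt<2N n<V e<V N<V²
      x (≤-<-trans (signBit≤1 x) 1<V) abs< (proj₁ (subtractInput-correct {e = e} x Φ+s≡ x-eq))
    where
    open ≤-Reasoning
    n = p * q
    s = p + q
    Φ = φ n
    N = Φ + R
    t = k * R ∸ 1
    L = ⌈log₂ (e * n) ⌉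
    V = 2 ^ (L * 1)

    1<n : 1 < n
    1<n = *-mono-≤ {2} {p} {1} (prime>1 pp) (<⇒≤ (prime>1 pq))

    Φ+s≡ : Φ + s ≡ suc n
    Φ+s≡ = φ-semiprime pp pq (<⇒≢ q<p ∘ sym)

    n∸s≤Φ : n ∸ s ≤ Φ
    n∸s≤Φ = ≤-trans (∸-monoˡ-≤ s (n≤1+n n)) (≤-reflexive (trans (cong (_∸ s) (sym Φ+s≡)) (m+n∸n≡m Φ s)))

    Φ<n : Φ < n
    Φ<n = ≤-pred (begin
      2 + Φ              ≡⟨ +-comm 2 Φ ⟩
      Φ + 2              ≤⟨ +-monoʳ-≤ Φ (≤-trans (prime>1 pp) (m≤m+n p q)) ⟩
      Φ + s              ≡⟨ Φ+s≡ ⟩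
      suc n              ∎)

    3eRd²<2Φ² : 3 * (e * R * (d * d)) < 2 * (Φ * Φ)
    3eRd²<2Φ² = <-≤-trans bound (*-monoʳ-≤ 2 (*-mono-≤ n∸s≤Φ n∸s≤Φ))

    1≤kR : 1 ≤ k * R
    1≤kR = *-mono-≤ 1≤k 0<R

    kN≡ : k * N ≡ e * d + t
    kN≡ = begin-equality
      k * (Φ + R)               ≡⟨ *-distribˡ-+ k Φ R ⟩
      k * Φ + k * R             ≡⟨ cong (_+_ (k * Φ)) (m+[n∸m]≡n 1≤kR) ⟨
      k * Φ + suc t             ≡⟨ +-suc (k * Φ) t ⟩
      suc (k * Φ) + t           ≡⟨ cong (_+ t) ed≡ ⟨
      e * d + t                 ∎

    -- Multiplying by `Φ` brings in `k Φ < e d`: `d t Φ ≤ d R (k Φ) ≤ e R d²`, and the bound on `d`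
    -- applies.
    3dt<2Φ : 3 * (d * t) < 2 * Φ
    3dt<2Φ = *-cancelʳ-< Φ (3 * (d * t)) (2 * Φ) (begin-strict
      3 * (d * t) * Φ           ≤⟨ *-monoˡ-≤ Φ (*-monoʳ-≤ 3 (*-monoʳ-≤ d (m∸n≤m (k * R) 1))) ⟩
      3 * (d * (k * R)) * Φ     ≡⟨ rearrange₁ d k R Φ ⟩
      3 * (d * R * (k * Φ))     ≤⟨ *-monoʳ-≤ 3 (*-monoʳ-≤ (d * R) (≤-trans (n≤1+n (k * Φ)) (≤-reflexive (sym ed≡)))) ⟩
      3 * (d * R * (e * d))     ≡⟨ rearrange₂ d R e ⟩
      3 * (e * R * (d * d))     <⟨ 3eRd²<2Φ² ⟩
      2 * (Φ * Φ)               ≡⟨ *-assoc 2 Φ Φ ⟨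
      2 * Φ * Φ                 ∎)
      where
      rearrange₁ : ∀ d k R Φ → 3 * (d * (k * R)) * Φ ≡ 3 * (d * R * (k * Φ))
      rearrange₁ = solve-∀
      rearrange₂ : ∀ d R e → 3 * (d * R * (e * d)) ≡ 3 * (e * R * (d * d))
      rearrange₂ = solve-∀

    3dt<2N : 3 * (d * t) < 2 * N
    3dt<2N = <-≤-trans 3dt<2Φ (*-monoʳ-≤ 2 (m≤m+n Φ R))

    t<N : t < N
    t<N = *-cancelˡ-< 3 t N (begin-strict
      3 * t                     ≤⟨ *-monoʳ-≤ 3 (m≤n*m t d {{>-nonZero 1≤d}}) ⟩
      3 * (d * t)               <⟨ 3dt<2N ⟩
      2 * N                     ≤⟨ *-monoˡ-≤ N (n≤1+n 2) ⟩
      3 * N                     ∎)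

    -- Since `e` and `d` are positive, `R ≤ e R d²`, so the bound on `d` also limits the unknown
    -- remainder; the sizes of `N` and of a negative `x` follow.
    R<Φ² : R < Φ * Φ
    R<Φ² = *-cancelˡ-< 3 R (Φ * Φ) (begin-strict
      3 * R                     ≤⟨ *-monoʳ-≤ 3 (≤-trans (m≤n*m R e {{>-nonZero (<-trans z<s 1<e)}}) (m≤m*n (e * R) (d * d) {{>-nonZero (*-mono-≤ 1≤d 1≤d)}})) ⟩
      3 * (e * R * (d * d))     <⟨ 3eRd²<2Φ² ⟩
      2 * (Φ * Φ)               ≤⟨ *-monoˡ-≤ (Φ * Φ) (n≤1+n 2) ⟩
      3 * (Φ * Φ)               ∎)

    en≤V : e * n ≤ V
    en≤V = subst (λ z → e * n ≤ 2 ^ z) (sym (*-identityʳ L)) (n≤2^⌈log₂n⌉ (e * n))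

    n<V : n < V
    n<V = <-≤-trans (m<m*n n e {{>-nonZero (<⇒≤ 1<n)}} 1<e) (≤-trans (≤-reflexive (*-comm n e)) en≤V)

    e<V : e < V
    e<V = <-≤-trans (m<m*n e n {{>-nonZero (<⇒≤ 1<e)}} 1<n) en≤V

    1<V : 1 < V
    1<V = <-trans 1<e e<V

    V*V≡ : V * V ≡ 2 ^ (L * 2)
    V*V≡ = trans (sym (^-distribˡ-+-* 2 (L * 1) (L * 1))) (cong (2 ^_) (sym (*-distribˡ-+ L 1 1)))

    1≤L : 1 ≤ L
    1≤L = n≢0⇒n>0 λ L≡0 → <-irrefl refl (subst (λ z → 1 < 2 ^ (z * 1)) L≡0 1<V)

    N<V² : N < 2 ^ (L * 2)
    N<V² = begin-strict
      Φ + R                     <⟨ +-monoʳ-< Φ R<Φ² ⟩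
      suc Φ * Φ                 ≤⟨ *-mono-≤ Φ<n (<⇒≤ Φ<n) ⟩
      n * n                     ≤⟨ *-mono-≤ (<⇒≤ n<V) (<⇒≤ n<V) ⟩
      V * V                     ≡⟨ V*V≡ ⟩
      2 ^ (L * 2)               ∎

    abs< : ℤ.∣ x ∣ < 2 ^ (L * 2)
    abs< with proj₂ (subtractInput-correct {e = e} x Φ+s≡ x-eq)
    ... | inj₁ ≤n = ≤-<-trans ≤n (<-≤-trans n<V (^-monoʳ-≤ 2 (*-monoʳ-≤ L (n≤1+n 1))))
    ... | inj₂ ≤N = ≤-<-trans ≤N N<V²

    signBit≤1 : ∀ x → signBit x ≤ 1
    signBit≤1 (+ _)    = z≤n
    signBit≤1 -[1+ _ ] = ≤-refl
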